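{- Let $q=3^n$ with $n\ge 1$, let $a,b\in\mathbb{F}_{q^2}^*$, and let \[ f(X)=X\bigl(1+aX^{q(q-1)}+bX^{2(q-1)}\bigr)\in\mathbb{F}_{q^2}[X]. \] If $f(X)$ is a permutation polynomial of $\mathbb{F}_{q^2}$ (i.e., the map $x\mapsto f(x)$ is a bijection of $\mathbb{F}_{q^2}$), then \[ a^qb^q=a\bigl(b^{q+1}-a^{q+1}\bigr) \] and $1-\left(\frac{b}{a}\right)^{q+1}$ is a square in $\mathbb{F}_q^*$.
   Context: $\mathbb{F}_q$ denotes the finite field with $q$ elements; $\mathbb{F}_q^*$ its multiplicative group. Note $(b/a)^{q+1}\in\mathbb{F}_q$. -}

module Defs where

open import Level using (Level)
import Data.Nat
open import Data.Nat using (ℕ; _^_; _∸_) renaming (_*_ to _*ℕ_)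
open import Data.Fin using (Fin)
open import Data.Product using (∃; _×_)
open import Relation.Nullary using (¬_)
open import Relation.Binary.PropositionalEquality as ≡ using ()
open import Algebra.Bundles using (CommutativeRing)
open import Function.Bundles using (Inverse)
open import Function.Definitions using (Bijective)
import Algebra.Definitions.RawSemiring as RS

record IsFiniteFieldOfOrder {c ℓ : Level} (K : CommutativeRing c ℓ) (m : ℕ) : Set (c Level.⊔ ℓ) where
  open CommutativeRing K
  field
    1≉0     : ¬ (1# ≈ 0#)
    _⁻¹     : Carrier → Carrier
    ⁻¹-inv  : ∀ x → ¬ (x ≈ 0#) → x * (x ⁻¹) ≈ 1#
    enum    : Inverse (≡.setoid (Fin m)) setoid

module Pow {c ℓ : Level} (K : CommutativeRing c ℓ) where
  open CommutativeRing K
  open import Algebra.Bundles using (Semiring)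

  infixr 8 _^ᴷ_
  _^ᴷ_ : Carrier → ℕ → Carrier
  _^ᴷ_ = RS._^_ (Semiring.rawSemiring semiring)

  polyF : ℕ → Carrier → Carrier → Carrier → Carrier
  polyF q a b x = x * ((1# + a * (x ^ᴷ (q *ℕ (q ∸ 1)))) + b * (x ^ᴷ (2 *ℕ (q ∸ 1))))

{-# OPTIONS --safe #-}
module Submission where

-- Write x̄ = x^q and q = 2m + 1. Then x x̄ f(x) = a x³ + x² x̄ + b x̄³, so f is homogeneous of degree 1
-- over 𝔽_q, and bijectivity says that each cubic expressing f(x) ∈ 𝔽_q v has exactly one root up to 𝔽_q.
-- Dividing out that root leaves a quadratic without roots, so the discriminant
--   D(v) = (v v̄)² + v v̄ (a v² + ā v̄²) - (b̄ v⁴ + b v̄⁴)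
-- is a nonzero square in 𝔽_q for every v ≠ 0. Hence D(v)^m = 1, that is, u² P(u)^m = 1 for
-- P = - b̄ + a X + X² + ā X³ - b X⁴ and every u = v^(q-1), so X² P^m ≡ 1 modulo X^(q+1) - 1.
-- Since m = 1 in 𝔽_3, P (P^m)′ = P′ P^m is a five-term recurrence for the coefficients of P^m, and three
-- instances of it together with the congruence give ā b̄ = a (b b̄ - a ā). Under this identity
-- D is aā / (aā - b b̄) times the square of a quadratic form over 𝔽_q, and D(1) is a square.

open import Defs
open import Level using (Level)
open import Data.Nat using (ℕ; zero; suc; _≤_; _<_; z≤n; s≤s; _≥_; _⊔_) renaming (_^_ to _^ℕ_; _*_ to _*ℕ_; _+_ to _+ℕ_)
import Data.Nat.Properties as ℕ
open import Data.Nat.Solver using (module +-*-Solver)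
open +-*-Solver using () renaming (solve to ℕ-solve; con to ℕcon; _:+_ to _ℕ:+_; _:*_ to _ℕ:*_; _:=_ to _ℕ:=_)
open import Data.Fin using (Fin; zero; suc; toℕ; punchIn; punchOut; _<?_)
import Data.Fin.Properties as Fin
open import Data.Fin.Permutation using (Permutation′; permutation)
open import Data.List using (List; []; _∷_; _++_; length; map; replicate; take; drop)
open import Data.List.Properties using (length-++; length-map; length-replicate; length-take; length-drop)
open import Data.List.Relation.Unary.All using (All; []; _∷_)
import Data.List.Relation.Unary.All.Properties as All
open import Data.Maybe using (Maybe; just; nothing)
open import Data.Product using (∃; _×_; _,_; proj₁; proj₂)
open import Data.Sum using (_⊎_; inj₁; inj₂; [_,_]′)
open import Data.Vec.Functional using (Vector; removeAt)
import Data.Vec.Functional as Vector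
open import Function using (_∘_; Inverse)
open import Function.Definitions using (Bijective; Injective; StrictlySurjective)
open import Relation.Nullary using (¬_; Dec; yes; no; contradiction)
open import Relation.Nullary.Decidable using (map′; decidable-stable)
open import Relation.Binary.PropositionalEquality as ≡ using (_≡_; _≢_)
open import Algebra.Bundles using (CommutativeRing; CommutativeMonoid; RawRing)
import Algebra.Properties.CommutativeMonoid.Mult as CommutativeMonoidMult
import Algebra.Properties.CommutativeMonoid.Sum as MonoidSum
import Algebra.Properties.CommutativeSemiring.Exp as Exp
import Algebra.Properties.Group as GroupProperties
import Algebra.Properties.Ring as RingProperties
import Algebra.Properties.Semiring.Mult as Mult
import Algebra.Solver.Ring
open import Algebra.Solver.Ring.AlmostCommutativeRing using (fromCommutativeRing; _-Raw-AlmostCommutative⟶_)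
import Algebra.Solver.Ring.NaturalCoefficients.Default as NaturalSolver
import Relation.Binary.Reasoning.Setoid as SetoidReasoning

-- The field 𝔽_q is never built: it is the fixed set of x ↦ x̄, and a square in 𝔽_q is a square with
-- a fixed root. A quadratic without roots ordinarily has a nonsquare discriminant. Here the outcome
-- is a square because the ratio y / x is written s + ε with ε̄ = - ε: the quadratic in s has
-- discriminant ε² D(v) up to squares of 𝔽_q, and ε² is not a square in 𝔽_q. Surjectivity of f
-- supplies the root that is divided out, injectivity excludes the others. Two facts that usually
-- rest on the cyclic multiplicative group are obtained by counting roots of polynomials instead:
-- that elements of 𝔽_q are squares in the field of order q², and the congruence modulo X^(q+1) - 1.
-- For the latter the roots of unity are not enumerated; X^(q-1) is substituted for X, and the
-- result vanishes on the whole field.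

injective⇒strictlySurjective : ∀ {n} {f : Fin n → Fin n} → Injective _≡_ _≡_ f → StrictlySurjective _≡_ f
injective⇒strictlySurjective {suc n} {f} inj j with Fin.any? (λ i → f i Fin.≟ j)
... | yes hit = hit
-- Were j missed, punching it out would inject `Fin (suc n)` into `Fin n`.
... | no miss = contradiction
  (λ {x y} e → inj (Fin.punchOut-injective (λ e → miss (x , ≡.sym e)) (λ e → miss (y , ≡.sym e)) e))
  (Fin.<⇒notInjective {f = λ i → punchOut {i = j} {j = f i} (λ e → miss (i , ≡.sym e))} (ℕ.n<1+n n))

module _ {c ℓ : Level} (M : CommutativeMonoid c ℓ) where
  open CommutativeMonoid M
  open MonoidSum M

  sum-supported-at : ∀ {n} (t : Vector Carrier n) (i : Fin n) → (∀ j → j ≢ i → t j ≈ ε) → sum t ≈ t i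
  sum-supported-at {suc n} t i zero-off = begin
    sum t                          ≈⟨ sum-remove {i = i} t ⟩
    t i ∙ sum (removeAt t i)       ≈⟨ ∙-congˡ (sum-cong-≋ (λ j → zero-off (punchIn i j) (Fin.punchInᵢ≢i i j))) ⟩
    t i ∙ sum (Vector.replicate n ε) ≈⟨ ∙-congˡ (sum-replicate-zero n) ⟩
    t i ∙ ε                        ≈⟨ identityʳ _ ⟩
    t i                            ∎
    where
    open SetoidReasoning setoid

HasCharacteristicThree : {c ℓ : Level} → CommutativeRing c ℓ → Set ℓ
HasCharacteristicThree K = 1# + (1# + 1#) ≈ 0#
  where
  open CommutativeRing K

-- The laws of x ↦ x^q on which the discriminant argument rests, for an abstract `bar`, so that no
-- power is unfolded there.
record IsInvolution {c ℓ : Level} (K : CommutativeRing c ℓ) (bar : CommutativeRing.Carrier K → CommutativeRing.Carrier K) : Set (c Level.⊔ ℓ) where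
  open CommutativeRing K
  field
    bar-cong : ∀ {x y} → x ≈ y → bar x ≈ bar y
    bar-+    : ∀ x y → bar (x + y) ≈ bar x + bar y
    bar-*    : ∀ x y → bar (x * y) ≈ bar x * bar y
    bar-bar  : ∀ x → bar (bar x) ≈ x

IsAdditivePower : {c ℓ : Level} → CommutativeRing c ℓ → ℕ → Set (c Level.⊔ ℓ)
IsAdditivePower K n = ∀ x y → (x + y) ^ᴷ n ≈ x ^ᴷ n + y ^ᴷ n
  where
  open CommutativeRing K
  open Pow K

IsOne : {c ℓ : Level} → CommutativeRing c ℓ → ℕ → Set ℓ
IsOne K m = m ×ᴷ 1# ≈ 1#
  where
  open CommutativeRing K
  open Mult semiring using () renaming (_×_ to _×ᴷ_)

Annihilates : {c ℓ : Level} → CommutativeRing c ℓ → ℕ → Set (c Level.⊔ ℓ)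
Annihilates K n = ∀ x → n ×ᴷ x ≈ 0#
  where
  open CommutativeRing K
  open Mult semiring using () renaming (_×_ to _×ᴷ_)

-- Polynomials as coefficient lists, constant term first, and the power rule.

module Polynomials {c ℓ : Level} (K : CommutativeRing c ℓ) where
  open CommutativeRing K hiding (zero)
  open Pow K using (_^ᴷ_)
  open Mult semiring using (×-congʳ; ×-comm-*) renaming (_×_ to _×ᴷ_)
  open CommutativeMonoidMult +-commutativeMonoid using (×-distrib-+)
  open NaturalSolver commutativeSemiring using (solve; con; _:+_; _:*_; _:=_)
  open SetoidReasoning setoid

  eval : List Carrier → Carrier → Carrier
  eval [] y = 0#
  eval (a ∷ p) y = a + y * eval p y

  eval-shift : ∀ k p y → eval (replicate k 0# ++ p) y ≈ y ^ᴷ k * eval p y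
  eval-shift zero p y = sym (*-identityˡ _)
  eval-shift (suc k) p y = trans (+-identityˡ _) (trans (*-congˡ (eval-shift k p y)) (sym (*-assoc _ _ _)))

  coef : List Carrier → ℕ → Carrier
  coef [] k = 0#
  coef (a ∷ p) zero = a
  coef (a ∷ p) (suc k) = coef p k

  coef-zero : ∀ {p} → All (_≈ 0#) p → ∀ k → coef p k ≈ 0#
  coef-zero [] k = refl
  coef-zero (e ∷ es) zero = e
  coef-zero (e ∷ es) (suc k) = coef-zero es k

  infixl 6 _⊕_
  _⊕_ : List Carrier → List Carrier → List Carrier
  [] ⊕ r = r
  (a ∷ p) ⊕ [] = a ∷ p
  (a ∷ p) ⊕ (b ∷ r) = (a + b) ∷ (p ⊕ r)

  infixl 7 _⊗_
  _⊗_ : List Carrier → List Carrier → List Carrier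
  [] ⊗ r = []
  (a ∷ p) ⊗ r = map (a *_) r ⊕ (0# ∷ p ⊗ r)

  power : List Carrier → ℕ → List Carrier
  power p zero = 1# ∷ []
  power p (suc m) = p ⊗ power p m

  length-⊕ : ∀ p r → length (p ⊕ r) ≡ length p ⊔ length r
  length-⊕ [] r = ≡.refl
  length-⊕ (a ∷ p) [] = ≡.refl
  length-⊕ (a ∷ p) (b ∷ r) = ≡.cong suc (length-⊕ p r)

  length-⊗ : ∀ p r → 1 ≤ length r → suc (length (p ⊗ r)) ≤ length p +ℕ length r
  length-⊗ [] r r≥1 = r≥1
  length-⊗ (a ∷ p) r r≥1 = s≤s (ℕ.≤-trans (ℕ.≤-reflexive (≡.trans (length-⊕ (map (a *_) r) _) (≡.cong (_⊔ _) (length-map _ r))))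
    (ℕ.⊔-lub (ℕ.m≤n+m (length r) (length p)) (length-⊗ p r r≥1)))

  length-⊗-positive : ∀ a p r → 1 ≤ length ((a ∷ p) ⊗ r)
  length-⊗-positive a p [] = s≤s z≤n
  length-⊗-positive a p (b ∷ r) = s≤s z≤n

  length-power : ∀ a p m → length (power (a ∷ p) m) ≤ suc (length p *ℕ m)
  length-power a p zero = s≤s z≤n
  length-power a p (suc m) = ℕ.≤-pred (ℕ.≤-trans (length-⊗ (a ∷ p) (power (a ∷ p) m) (positive m))
      (s≤s (ℕ.≤-trans (ℕ.+-monoʳ-≤ (length p) (length-power a p m)) (ℕ.≤-reflexive (≡.trans (ℕ.+-suc _ _) (≡.cong suc (≡.sym (ℕ.*-suc (length p) m))))))))
    where
    positive : ∀ m → 1 ≤ length (power (a ∷ p) m)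
    positive zero = s≤s z≤n
    positive (suc m) = length-⊗-positive a p (power (a ∷ p) m)

  eval-⊕ : ∀ p r y → eval (p ⊕ r) y ≈ eval p y + eval r y
  eval-⊕ [] r y = sym (+-identityˡ _)
  eval-⊕ (a ∷ p) [] y = sym (+-identityʳ _)
  eval-⊕ (a ∷ p) (b ∷ r) y = trans (+-congˡ (*-congˡ (eval-⊕ p r y)))
    (solve 5 (λ a b y s t → (a :+ b) :+ y :* (s :+ t) := (a :+ y :* s) :+ (b :+ y :* t)) refl a b y _ _)

  eval-scale : ∀ a p y → eval (map (a *_) p) y ≈ a * eval p y
  eval-scale a [] y = sym (zeroʳ a)
  eval-scale a (b ∷ p) y = trans (+-congˡ (*-congˡ (eval-scale a p y)))
    (solve 4 (λ a b y s → a :* b :+ y :* (a :* s) := a :* (b :+ y :* s)) refl a b y _)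

  eval-⊗ : ∀ p r y → eval (p ⊗ r) y ≈ eval p y * eval r y
  eval-⊗ [] r y = sym (zeroˡ _)
  eval-⊗ (a ∷ p) r y = begin
    eval (map (a *_) r ⊕ (0# ∷ p ⊗ r)) y          ≈⟨ eval-⊕ (map (a *_) r) _ y ⟩
    eval (map (a *_) r) y + (0# + y * eval (p ⊗ r) y) ≈⟨ +-cong (eval-scale a r y) (+-congˡ (*-congˡ (eval-⊗ p r y))) ⟩
    a * eval r y + (0# + y * (eval p y * eval r y)) ≈⟨ solve 4 (λ a y p r → a :* r :+ (con 0 :+ y :* (p :* r)) := (a :+ y :* p) :* r) refl a y _ _ ⟩
    (a + y * eval p y) * eval r y                  ∎

  eval-power : ∀ p m y → eval (power p m) y ≈ eval p y ^ᴷ m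
  eval-power p zero y = trans (+-congˡ (zeroʳ y)) (+-identityʳ 1#)
  eval-power p (suc m) y = trans (eval-⊗ p (power p m) y) (*-congˡ (eval-power p m y))

  eval-split : ∀ l p y → eval p y ≈ eval (take l p) y + y ^ᴷ l * eval (drop l p) y
  eval-split zero p y = solve 1 (λ s → s := con 0 :+ con 1 :* s) refl _
  eval-split (suc l) [] y = sym (trans (+-identityˡ _) (zeroʳ _))
  eval-split (suc l) (a ∷ p) y = trans (+-congˡ (*-congˡ (eval-split l p y)))
    (solve 5 (λ a y s t u → a :+ y :* (s :+ t :* u) := (a :+ y :* s) :+ (y :* t) :* u) refl a y _ _ _)

  coef-⊕ : ∀ p r k → coef (p ⊕ r) k ≈ coef p k + coef r k
  coef-⊕ [] r k = sym (+-identityˡ _)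
  coef-⊕ (a ∷ p) [] k = sym (+-identityʳ _)
  coef-⊕ (a ∷ p) (b ∷ r) zero = refl
  coef-⊕ (a ∷ p) (b ∷ r) (suc k) = coef-⊕ p r k

  coef-scale : ∀ a p k → coef (map (a *_) p) k ≈ a * coef p k
  coef-scale a [] k = sym (zeroʳ a)
  coef-scale a (b ∷ p) zero = refl
  coef-scale a (b ∷ p) (suc k) = coef-scale a p k

  coef-take : ∀ {l} p {k} → k < l → coef (take l p) k ≡ coef p k
  coef-take [] {k} (s≤s _) = ≡.refl
  coef-take (a ∷ p) {zero} (s≤s _) = ≡.refl
  coef-take (a ∷ p) {suc k} (s≤s k<l) = coef-take p k<l

  coef-drop : ∀ l p k → coef (drop l p) k ≡ coef p (l +ℕ k)
  coef-drop zero p k = ≡.refl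
  coef-drop (suc l) [] k = ≡.refl
  coef-drop (suc l) (a ∷ p) k = coef-drop l p k

  infix 4 _≋_
  _≋_ : (f g : ℕ → Carrier) → Set _
  f ≋ g = ∀ k → f k ≈ g k

  shift : (ℕ → Carrier) → ℕ → Carrier
  shift f zero = 0#
  shift f (suc k) = f k

  -- The coefficient sequence of p times the power series with coefficients f.
  infixr 7 _·_
  _·_ : List Carrier → (ℕ → Carrier) → ℕ → Carrier
  ([] · f) k = 0#
  ((a ∷ p) · f) k = a * f k + shift (p · f) k

  shift-cong : ∀ {f g} → f ≋ g → shift f ≋ shift g
  shift-cong e zero = refl
  shift-cong e (suc k) = e k

  ·-cong : ∀ p {f g} → f ≋ g → p · f ≋ p · g
  ·-cong [] e k = refl
  ·-cong (a ∷ p) e k = +-cong (*-congˡ (e k)) (shift-cong (·-cong p e) k)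

  coef-⊗ : ∀ p r → coef (p ⊗ r) ≋ p · coef r
  coef-⊗ [] r k = refl
  coef-⊗ (a ∷ p) r k = trans (coef-⊕ (map (a *_) r) _ k) (+-cong (coef-scale a r k) (shifted k))
    where
    shifted : coef (0# ∷ p ⊗ r) ≋ shift (p · coef r)
    shifted zero = refl
    shifted (suc k) = coef-⊗ p r k

  shift-+ : ∀ f g → shift (λ k → f k + g k) ≋ (λ k → shift f k + shift g k)
  shift-+ f g zero = sym (+-identityʳ 0#)
  shift-+ f g (suc k) = refl

  shift-* : ∀ t f → shift (λ k → t * f k) ≋ (λ k → t * shift f k)
  shift-* t f zero = sym (zeroʳ t)
  shift-* t f (suc k) = refl

  ·-+ : ∀ p f g → p · (λ k → f k + g k) ≋ (λ k → (p · f) k + (p · g) k)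
  ·-+ [] f g k = sym (+-identityʳ 0#)
  ·-+ (a ∷ p) f g k = trans (+-congˡ (trans (shift-cong (·-+ p f g) k) (shift-+ (p · f) (p · g) k)))
    (solve 5 (λ a x y s t → a :* (x :+ y) :+ (s :+ t) := (a :* x :+ s) :+ (a :* y :+ t)) refl a _ _ _ _)

  ·-* : ∀ p t f → p · (λ k → t * f k) ≋ (λ k → t * (p · f) k)
  ·-* [] t f k = sym (zeroʳ t)
  ·-* (a ∷ p) t f k = trans (+-congˡ (trans (shift-cong (·-* p t f) k) (shift-* t (p · f) k)))
    (solve 4 (λ a t x s → a :* (t :* x) :+ t :* s := t :* (a :* x :+ s)) refl a t _ _)

  ·-shift : ∀ p f → p · shift f ≋ shift (p · f)
  ·-shift [] f zero = refl
  ·-shift [] f (suc k) = refl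
  ·-shift (a ∷ p) f zero = trans (+-identityʳ _) (zeroʳ a)
  ·-shift (a ∷ p) f (suc k) = +-congˡ (·-shift p f k)

  ⊕-· : ∀ p r f → (p ⊕ r) · f ≋ (λ k → (p · f) k + (r · f) k)
  ⊕-· [] r f k = sym (+-identityˡ _)
  ⊕-· (a ∷ p) [] f k = sym (+-identityʳ _)
  ⊕-· (a ∷ p) (b ∷ r) f k = trans (+-congˡ (trans (shift-cong (⊕-· p r f) k) (shift-+ (p · f) (r · f) k)))
    (solve 5 (λ a b x s t → (a :+ b) :* x :+ (s :+ t) := (a :* x :+ s) :+ (b :* x :+ t)) refl a b _ _ _)

  ·-comm : ∀ p r f → p · (r · f) ≋ r · (p · f)
  ·-comm [] r f k = sym (trans (·-cong r (λ j → sym (zeroˡ 0#)) k) (trans (·-* r 0# (λ _ → 0#) k) (zeroˡ _)))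
  ·-comm (a ∷ p) r f k = begin
    a * (r · f) k + shift (p · (r · f)) k          ≈⟨ +-cong (sym (·-* r a f k)) (trans (shift-cong (·-comm p r f) k) (sym (·-shift r (p · f) k))) ⟩
    (r · (λ j → a * f j)) k + (r · shift (p · f)) k ≈⟨ ·-+ r _ _ k ⟨
    (r · ((a ∷ p) · f)) k                          ∎

  -- The Euler operator X d/dX, which unlike d/dX leaves every index in place.
  θ : (ℕ → Carrier) → ℕ → Carrier
  θ f k = k ×ᴷ f k

  -- The coefficients of X p′.
  δ : List Carrier → List Carrier
  δ [] = []
  δ (a ∷ p) = 0# ∷ (p ⊕ δ p)

  θ-cong : ∀ {f g} → f ≋ g → θ f ≋ θ g
  θ-cong e k = ×-congʳ k (e k)

  leibniz : ∀ p f → θ (p · f) ≋ (λ k → (δ p · f) k + (p · θ f) k)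
  leibniz [] f k = trans (trans (×-congʳ k (sym (zeroˡ 0#))) (trans (sym (×-comm-* k 0# 0#)) (zeroˡ _))) (sym (+-identityʳ 0#))
  leibniz (a ∷ p) f zero = solve 2 (λ a x → con 0 := (con 0 :* x :+ con 0) :+ (a :* con 0 :+ con 0)) refl a (f 0)
  leibniz (a ∷ p) f (suc j) = begin
    suc j ×ᴷ (a * f (suc j) + (p · f) j)                       ≈⟨ ×-distrib-+ _ _ (suc j) ⟩
    suc j ×ᴷ (a * f (suc j)) + ((p · f) j + θ (p · f) j)       ≈⟨ +-cong (sym (×-comm-* (suc j) a _)) (+-congˡ (leibniz p f j)) ⟩
    a * θ f (suc j) + ((p · f) j + ((δ p · f) j + (p · θ f) j))
      ≈⟨ solve 5 (λ y x s t u → y :+ (s :+ (t :+ u)) := (con 0 :* x :+ (s :+ t)) :+ (y :+ u)) refl (a * θ f (suc j)) (f (suc j)) _ _ _ ⟩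
    (0# * f (suc j) + ((p · f) j + (δ p · f) j)) + (a * θ f (suc j) + (p · θ f) j)
      ≈⟨ +-congʳ (+-congˡ (⊕-· p (δ p) f j)) ⟨
    (δ (a ∷ p) · f) (suc j) + ((a ∷ p) · θ f) (suc j)          ∎

  -- The factor p avoids p^(m-1): in X (p pᵐ)′ = X p′ pᵐ + p X (pᵐ)′ it leaves the second term ready
  -- for the induction hypothesis.
  power-rule : ∀ p m → p · θ (coef (power p m)) ≋ (λ k → (m ×ᴷ 1#) * (δ p · coef (power p m)) k)
  power-rule p zero k = trans (·-cong p θ1≈0 k) (trans (·-* p 0# (λ _ → 0#) k) (trans (zeroˡ _) (sym (zeroˡ _))))
    where
    θ1≈0 : θ (coef (1# ∷ [])) ≋ (λ _ → 0# * 0#)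
    θ1≈0 zero = sym (zeroˡ 0#)
    θ1≈0 (suc k) = trans (×-congʳ (suc k) (sym (zeroˡ 0#))) (trans (sym (×-comm-* (suc k) 0# 0#)) (trans (zeroˡ _) (sym (zeroˡ _))))
  power-rule p (suc m) k = begin
    (p · θ (coef (p ⊗ power p m))) k                  ≈⟨ ·-cong p (λ j → trans (θ-cong (coef-⊗ p (power p m)) j) (leibniz p C j)) k ⟩
    (p · (λ j → (δ p · C) j + (p · θ C) j)) k         ≈⟨ ·-+ p (δ p · C) (p · θ C) k ⟩
    (p · (δ p · C)) k + (p · (p · θ C)) k             ≈⟨ +-congˡ (trans (·-cong p (power-rule p m) k) (·-* p M (δ p · C) k)) ⟩
    (p · (δ p · C)) k + M * (p · (δ p · C)) k         ≈⟨ solve 2 (λ s t → s :+ t :* s := (con 1 :+ t) :* s) refl _ M ⟩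
    (1# + M) * (p · (δ p · C)) k                      ≈⟨ *-congˡ (trans (·-comm p (δ p) C k) (·-cong (δ p) (λ j → sym (coef-⊗ p (power p m) j)) k)) ⟩
    (1# + M) * (δ p · coef (p ⊗ power p m)) k         ∎
    where
    C = coef (power p m)
    M = m ×ᴷ 1#

-- Finite fields: Fermat's theorem, root counting, squares.

module FiniteField {c ℓ : Level} (K : CommutativeRing c ℓ) {N : ℕ} (FF : IsFiniteFieldOfOrder K N) where
  open CommutativeRing K hiding (zero)
  open IsFiniteFieldOfOrder FF
  open Pow K using (_^ᴷ_)
  open Polynomials K
  open Exp commutativeSemiring using (^-congˡ)
  open Mult semiring using () renaming (_×_ to _×ᴷ_)
  open GroupProperties +-group using (x∙y⁻¹≈ε⇒x≈y; x≈y⇒x∙y⁻¹≈ε)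
  open RingProperties ring using (-‿distribʳ-*; -0#≈0#; -‿involutive; +-cancelˡ; +-cancelʳ)
  open NaturalSolver commutativeSemiring using (solve; con; _:+_; _:*_; _:=_)
  open Inverse enum using (to; from; from-cong)
  open SetoidReasoning setoid

  to∘from : ∀ x → to (from x) ≈ x
  to∘from = Inverse.strictlyInverseˡ enum

  from∘to : ∀ i → from (to i) ≡ i
  from∘to = Inverse.strictlyInverseʳ enum

  from-injective : ∀ {x y} → from x ≡ from y → x ≈ y
  from-injective {x} {y} e = trans (sym (to∘from x)) (trans (reflexive (≡.cong to e)) (to∘from y))

  infix 4 _≟_
  _≟_ : ∀ x y → Dec (x ≈ y)
  x ≟ y = map′ from-injective from-cong (from x Fin.≟ from y)

  ⁻¹-invˡ : ∀ {x} → ¬ (x ≈ 0#) → (x ⁻¹) * x ≈ 1#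
  ⁻¹-invˡ x≉0 = trans (*-comm _ _) (⁻¹-inv _ x≉0)

  *-cancelˡ : ∀ {x y z} → ¬ (x ≈ 0#) → x * y ≈ x * z → y ≈ z
  *-cancelˡ {x} {y} {z} x≉0 e = begin
    y                 ≈⟨ *-identityˡ y ⟨
    1# * y            ≈⟨ *-congʳ (⁻¹-invˡ x≉0) ⟨
    ((x ⁻¹) * x) * y  ≈⟨ *-assoc _ _ _ ⟩
    (x ⁻¹) * (x * y)  ≈⟨ *-congˡ e ⟩
    (x ⁻¹) * (x * z)  ≈⟨ *-assoc _ _ _ ⟨
    ((x ⁻¹) * x) * z  ≈⟨ *-congʳ (⁻¹-invˡ x≉0) ⟩
    1# * z            ≈⟨ *-identityˡ z ⟩
    z                 ∎

  xy≈0⇒y≈0 : ∀ {x y} → ¬ (x ≈ 0#) → x * y ≈ 0# → y ≈ 0#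
  xy≈0⇒y≈0 x≉0 e = *-cancelˡ x≉0 (trans e (sym (zeroʳ _)))

  xy≈0⇒x≈0∨y≈0 : ∀ {x y} → x * y ≈ 0# → (x ≈ 0#) ⊎ (y ≈ 0#)
  xy≈0⇒x≈0∨y≈0 {x} e with x ≟ 0#
  ... | yes x≈0 = inj₁ x≈0
  ... | no x≉0 = inj₂ (xy≈0⇒y≈0 x≉0 e)

  *-≉0 : ∀ {x y} → ¬ (x ≈ 0#) → ¬ (y ≈ 0#) → ¬ (x * y ≈ 0#)
  *-≉0 x≉0 y≉0 e = y≉0 (xy≈0⇒y≈0 x≉0 e)

  ^-≉0 : ∀ {x} n → ¬ (x ≈ 0#) → ¬ (x ^ᴷ n ≈ 0#)
  ^-≉0 zero x≉0 = 1≉0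
  ^-≉0 (suc n) x≉0 = *-≉0 x≉0 (^-≉0 n x≉0)

  ^≈0⇒≈0 : ∀ {x} n → x ^ᴷ n ≈ 0# → x ≈ 0#
  ^≈0⇒≈0 {x} n e with x ≟ 0#
  ... | yes x≈0 = x≈0
  ... | no x≉0 = contradiction e (^-≉0 n x≉0)

  ⁻¹-≉0 : ∀ {x} → ¬ (x ≈ 0#) → ¬ (x ⁻¹ ≈ 0#)
  ⁻¹-≉0 x≉0 e = 1≉0 (trans (sym (⁻¹-inv _ x≉0)) (trans (*-congˡ e) (zeroʳ _)))

  module _ {m ℓ′ : Level} (M : CommutativeMonoid m ℓ′) where
    private module M = CommutativeMonoid M
    open MonoidSum M using (sum; sum-permute; sum-cong-≋)

    sum-reindex : (φ : Carrier → M.Carrier) → (∀ {x y} → x ≈ y → φ x M.≈ φ y) →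
      (τ τ⁻¹ : Carrier → Carrier) → (∀ {x y} → x ≈ y → τ x ≈ τ y) → (∀ {x y} → x ≈ y → τ⁻¹ x ≈ τ⁻¹ y) →
      (∀ x → τ (τ⁻¹ x) ≈ x) → (∀ x → τ⁻¹ (τ x) ≈ x) →
      sum (λ i → φ (to i)) M.≈ sum (λ i → φ (τ (to i)))
    sum-reindex φ φ-cong τ τ⁻¹ τ-cong τ⁻¹-cong τ∘τ⁻¹ τ⁻¹∘τ =
      M.trans (sum-permute (φ ∘ to) π) (sum-cong-≋ (λ i → φ-cong (to∘from (τ (to i)))))
      where
      π : Permutation′ N
      π = permutation (λ i → from (τ (to i))) (λ i → from (τ⁻¹ (to i)))
        (λ i → ≡.trans (from-cong (trans (τ-cong (to∘from _)) (τ∘τ⁻¹ _))) (from∘to i))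
        (λ i → ≡.trans (from-cong (trans (τ⁻¹-cong (to∘from _)) (τ⁻¹∘τ _))) (from∘to i))

  -- Translation by 1 permutes the field, so the sum of all elements equals itself plus N times 1.
  N×1≈0 : N ×ᴷ 1# ≈ 0#
  N×1≈0 = sym (x∙y⁻¹≈ε⇒x≈y 0# _ (begin
      0# - N ×ᴷ 1#                     ≈⟨ +-congʳ (-‿inverseʳ Σx) ⟨
      (Σx - Σx) - N ×ᴷ 1#              ≈⟨ +-congʳ (+-congʳ translate) ⟩
      ((Σx + N ×ᴷ 1#) - Σx) - N ×ᴷ 1#  ≈⟨ +-congʳ (+-congʳ (+-comm _ _)) ⟩
      ((N ×ᴷ 1# + Σx) - Σx) - N ×ᴷ 1#  ≈⟨ +-congʳ (trans (+-assoc _ _ _) (trans (+-congˡ (-‿inverseʳ Σx)) (+-identityʳ _))) ⟩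
      N ×ᴷ 1# - N ×ᴷ 1#                ≈⟨ -‿inverseʳ _ ⟩
      0#                               ∎))
    where
    open MonoidSum +-commutativeMonoid
    Σx = sum to
    translate : Σx ≈ Σx + N ×ᴷ 1#
    translate = begin
      Σx                          ≈⟨ sum-reindex +-commutativeMonoid (λ x → x) (λ e → e) (_+ 1#) (_- 1#) +-congʳ +-congʳ
                                      (λ x → trans (+-assoc _ _ _) (trans (+-congˡ (-‿inverseˡ 1#)) (+-identityʳ x)))
                                      (λ x → trans (+-assoc _ _ _) (trans (+-congˡ (-‿inverseʳ 1#)) (+-identityʳ x))) ⟩
      sum (λ i → to i + 1#)       ≈⟨ ∑-distrib-+ to _ ⟩
      Σx + sum (Vector.replicate N 1#) ≈⟨ +-congˡ (sum-replicate N) ⟩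
      Σx + N ×ᴷ 1#                ∎

  -- An inhabitant of `Fin n` serves as the proof that n is positive.
  0^ : ∀ {n} → Fin n → 0# ^ᴷ n ≈ 0#
  0^ {suc n} _ = zeroˡ _

  -- Multiplication by x permutes the nonzero elements, and the factor x missing at 0 is restored by h.
  fermat : ∀ x → x ^ᴷ N ≈ x
  fermat x with x ≟ 0#
  ... | yes x≈0 = trans (^-congˡ N x≈0) (trans (0^ (from 0#)) (sym x≈0))
  ... | no x≉0 = sym (*-cancelˡ Π≉0 (begin
      product (g ∘ to) * x                                     ≈⟨ *-cong Πg Πh ⟩
      product (λ i → g (x * to i)) * product (h ∘ to)           ≈⟨ ∑-distrib-+ (λ i → g (x * to i)) (h ∘ to) ⟨
      product (λ i → g (x * to i) * h (to i))                   ≈⟨ sum-cong-≋ (λ i → gh (to i)) ⟩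
      product (λ i → g (to i) * x)                              ≈⟨ ∑-distrib-+ (g ∘ to) _ ⟩
      product (g ∘ to) * product (Vector.replicate N x)         ≈⟨ *-congˡ (sum-replicate N) ⟩
      product (g ∘ to) * x ^ᴷ N                                 ∎))
    where
    open MonoidSum *-commutativeMonoid renaming (sum to product)
    g h : Carrier → Carrier
    g y with y ≟ 0#
    ... | yes _ = 1#
    ... | no _ = y
    h y with y ≟ 0#
    ... | yes _ = x
    ... | no _ = 1#
    g-cong : ∀ {y z} → y ≈ z → g y ≈ g z
    g-cong {y} {z} e with y ≟ 0# | z ≟ 0#
    ... | yes _ | yes _ = refl
    ... | yes p | no q = contradiction (trans (sym e) p) q
    ... | no p | yes q = contradiction (trans e q) p
    ... | no _ | no _ = e
    g≉0 : ∀ y → ¬ (g y ≈ 0#)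
    g≉0 y with y ≟ 0#
    ... | yes _ = 1≉0
    ... | no y≉0 = y≉0
    gh : ∀ y → g (x * y) * h y ≈ g y * x
    gh y with y ≟ 0# | x * y ≟ 0#
    ... | yes _ | yes _ = refl
    ... | yes y≈0 | no xy≉0 = contradiction (trans (*-congˡ y≈0) (zeroʳ x)) xy≉0
    ... | no y≉0 | yes xy≈0 = contradiction xy≈0 (*-≉0 x≉0 y≉0)
    ... | no _ | no _ = trans (*-identityʳ _) (*-comm _ _)
    Πh : x ≈ product (h ∘ to)
    Πh = sym (trans (sum-supported-at *-commutativeMonoid (h ∘ to) (from 0#) off) at)
      where
      off : ∀ j → j ≢ from 0# → h (to j) ≈ 1#
      off j j≢ with to j ≟ 0#
      ... | yes e = contradiction (≡.trans (≡.sym (from∘to j)) (from-cong e)) j≢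
      ... | no _ = refl
      at : h (to (from 0#)) ≈ x
      at with to (from 0#) ≟ 0#
      ... | yes _ = refl
      ... | no e = contradiction (to∘from 0#) e
    Πg : product (g ∘ to) ≈ product (λ i → g (x * to i))
    Πg = sum-reindex *-commutativeMonoid g g-cong (x *_) ((x ⁻¹) *_) *-congˡ *-congˡ
      (λ y → trans (sym (*-assoc _ _ _)) (trans (*-congʳ (⁻¹-inv x x≉0)) (*-identityˡ y)))
      (λ y → trans (sym (*-assoc _ _ _)) (trans (*-congʳ (⁻¹-invˡ x≉0)) (*-identityˡ y)))
    product≉0 : ∀ {n} (t : Vector Carrier n) → (∀ i → ¬ (t i ≈ 0#)) → ¬ (product t ≈ 0#)
    product≉0 {zero} t t≉0 = 1≉0
    product≉0 {suc n} t t≉0 = *-≉0 (t≉0 zero) (product≉0 (t ∘ suc) (t≉0 ∘ suc))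
    Π≉0 : ¬ (product (g ∘ to) ≈ 0#)
    Π≉0 = product≉0 (g ∘ to) (λ i → g≉0 (to i))

  IsZero : List Carrier → Set _
  IsZero = All (_≈ 0#)

  eval-zero : ∀ {p} → IsZero p → ∀ y → eval p y ≈ 0#
  eval-zero [] y = refl
  eval-zero (a≈0 ∷ p≈0) y = trans (+-cong a≈0 (trans (*-congˡ (eval-zero p≈0 y)) (zeroʳ y))) (+-identityʳ 0#)

  -- Synthetic division of X p(X) - α p(α) by X - α.
  quotient : Carrier → List Carrier → List Carrier
  quotient α [] = []
  quotient α (a ∷ p) = eval (a ∷ p) α ∷ quotient α p

  length-quotient : ∀ α p → length (quotient α p) ≡ length p
  length-quotient α [] = ≡.refl
  length-quotient α (a ∷ p) = ≡.cong suc (length-quotient α p)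

  -- This is (y - α) S(y) = y p(y) - α p(α) for the quotient S, with negative terms moved across so
  -- that the semiring solver applies.
  eval-quotient : ∀ α p y → y * eval (quotient α p) y + α * eval p α ≈ α * eval (quotient α p) y + y * eval p y
  eval-quotient α [] y = +-comm _ _
  eval-quotient α (a ∷ p) y = begin
    y * ((a + α * A) + y * S) + α * (a + α * A)
      ≈⟨ solve 5 (λ y α a A S → y :* ((a :+ α :* A) :+ y :* S) :+ α :* (a :+ α :* A)
           := y :* (y :* S :+ α :* A) :+ (y :* a :+ α :* (a :+ α :* A))) refl y α a A S ⟩
    y * (y * S + α * A) + (y * a + α * (a + α * A))
      ≈⟨ +-congʳ (*-congˡ (eval-quotient α p y)) ⟩
    y * (α * S + y * B) + (y * a + α * (a + α * A))
      ≈⟨ solve 6 (λ y α a A S B → y :* (α :* S :+ y :* B) :+ (y :* a :+ α :* (a :+ α :* A))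
           := α :* ((a :+ α :* A) :+ y :* S) :+ y :* (a :+ y :* B)) refl y α a A S B ⟩
    α * ((a + α * A) + y * S) + y * (a + y * B) ∎
    where
    A = eval p α
    S = eval (quotient α p) y
    B = eval p y

  quotient-zero : ∀ α p → IsZero (quotient α p) → IsZero p
  quotient-zero α [] [] = []
  quotient-zero α (a ∷ p) (e ∷ es) = trans (sym (trans (+-congˡ αp≈0) (+-identityʳ a))) e ∷ p≈0
    where
    p≈0 = quotient-zero α p es
    αp≈0 = trans (*-congˡ (eval-zero p≈0 α)) (zeroʳ α)

  -- If α is a root of a ∷ p, the constant a cancels against the value at α: what remains is (X - α)
  -- times the quotient of the tail, which has one coefficient fewer and keeps the other roots.
  root-bound : ∀ {m} (z : Fin m → Carrier) → (∀ {i j} → z i ≈ z j → i ≡ j) →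
    ∀ p → length p ≤ m → (∀ i → eval p (z i) ≈ 0#) → IsZero p
  root-bound z z-inj [] _ _ = []
  root-bound {suc m} z z-inj (a ∷ p) (s≤s p≤m) roots =
    trans (sym (trans (+-congˡ (trans (*-congˡ (eval-zero p≈0 α)) (zeroʳ α))) (+-identityʳ a))) (roots zero) ∷ p≈0
    where
    α = z zero
    quotient-root : ∀ i → eval (quotient α p) (z (suc i)) ≈ 0#
    quotient-root i = [ (λ S≈0 → S≈0) , (λ yα → contradiction (z-inj (x∙y⁻¹≈ε⇒x≈y _ _ yα)) λ ()) ]′
      (xy≈0⇒x≈0∨y≈0 (begin
        S * (y - α)        ≈⟨ trans (distribˡ S y (- α)) (+-cong (*-comm S y) (trans (sym (-‿distribʳ-* S α)) (-‿cong (*-comm S α)))) ⟩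
        y * S - α * S      ≈⟨ x≈y⇒x∙y⁻¹≈ε yS≈αS ⟩
        0#                 ∎))
      where
      y = z (suc i)
      S = eval (quotient α p) y
      αA≈yB : α * eval p α ≈ y * eval p y
      αA≈yB = +-cancelˡ a _ _ (trans (roots zero) (sym (roots (suc i))))
      yS≈αS : y * S ≈ α * S
      yS≈αS = +-cancelʳ (α * eval p α) _ _ (trans (eval-quotient α p y) (+-congˡ (sym αA≈yB)))
    p≈0 : IsZero p
    p≈0 = quotient-zero α p (root-bound (z ∘ suc) (Fin.suc-injective ∘ z-inj) (quotient α p)
      (ℕ.≤-trans (ℕ.≤-reflexive (length-quotient α p)) p≤m) quotient-root)

  vanishing⇒zero : ∀ p → length p ≤ N → (∀ y → eval p y ≈ 0#) → IsZero p
  vanishing⇒zero p p≤N p≈0 = root-bound to (λ {i} {j} e → ≡.trans (≡.sym (from∘to i)) (≡.trans (from-cong e) (from∘to j)))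
    p p≤N (p≈0 ∘ to)

  -- Otherwise X^(k+2) - X, of degree below N, vanishes on the field although its coefficient at X
  -- is -1.
  ∃-not-fixed : ∀ k → 3 +ℕ k ≤ N → ∃ λ y → ¬ (y ^ᴷ (2 +ℕ k) ≈ y)
  ∃-not-fixed k k<N with Fin.¬∀⟶∃¬ N _ (λ i → to i ^ᴷ (2 +ℕ k) ≟ to i) not-all
    where
    p = 0# ∷ - 1# ∷ (replicate k 0# ++ (1# ∷ []))
    length-p : length p ≡ 3 +ℕ k
    length-p = ≡.cong (2 +ℕ_) (≡.trans (length-++ (replicate k 0#)) (≡.trans (≡.cong (_+ℕ 1) (length-replicate k)) (ℕ.+-comm k 1)))
    eval-p : ∀ y → y ^ᴷ (2 +ℕ k) ≈ y → eval p y ≈ 0#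
    eval-p y e = begin
      0# + y * (- 1# + y * eval (replicate k 0# ++ (1# ∷ [])) y)
        ≈⟨ trans (+-identityˡ _) (*-congˡ (+-congˡ (*-congˡ (eval-shift k _ y)))) ⟩
      y * (- 1# + y * (y ^ᴷ k * (1# + y * 0#)))
        ≈⟨ solve 3 (λ y m t → y :* (m :+ y :* (t :* (con 1 :+ y :* con 0))) := y :* (y :* t) :+ y :* m) refl y (- 1#) (y ^ᴷ k) ⟩
      y ^ᴷ (2 +ℕ k) + y * - 1#
        ≈⟨ +-cong e (trans (sym (-‿distribʳ-* y 1#)) (-‿cong (*-identityʳ y))) ⟩
      y - y
        ≈⟨ -‿inverseʳ y ⟩
      0# ∎
    not-all : ¬ (∀ i → to i ^ᴷ (2 +ℕ k) ≈ to i)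
    not-all fixed with vanishing⇒zero p (ℕ.≤-trans (ℕ.≤-reflexive length-p) k<N)
      (λ y → eval-p y (trans (^-congˡ (2 +ℕ k) (sym (to∘from y))) (trans (fixed (from y)) (to∘from y))))
    ... | _ ∷ -1≈0 ∷ _ = 1≉0 (trans (sym (-‿involutive 1#)) (trans (-‿cong -1≈0) -0#≈0#))
  ... | i , not-fixed = to i , not-fixed

  inflate : ℕ → List Carrier → List Carrier
  inflate d [] = []
  inflate d (a ∷ p) = a ∷ (replicate d 0# ++ inflate d p)

  length-inflate : ∀ d p → length (inflate d p) ≡ length p *ℕ suc d
  length-inflate d [] = ≡.refl
  length-inflate d (a ∷ p) = ≡.cong suc (≡.trans (length-++ (replicate d 0#))
    (≡.cong₂ _+ℕ_ (length-replicate d) (length-inflate d p)))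

  eval-inflate : ∀ d p y → eval (inflate d p) y ≈ eval p (y ^ᴷ suc d)
  eval-inflate d [] y = refl
  eval-inflate d (a ∷ p) y = +-congˡ (trans (*-congˡ (trans (eval-shift d _ y) (*-congˡ (eval-inflate d p y)))) (sym (*-assoc _ _ _)))

  inflate-zero : ∀ d p → IsZero (inflate d p) → IsZero p
  inflate-zero d [] [] = []
  inflate-zero d (a ∷ p) (e ∷ es) = e ∷ inflate-zero d p (All.++⁻ʳ (replicate d 0#) es)

  vanishing-on-powers⇒zero : ∀ d p → suc (length p *ℕ suc d) ≤ N →
    (∀ y → ¬ (y ≈ 0#) → eval p (y ^ᴷ suc d) ≈ 0#) → IsZero p
  -- The extra factor X forces a zero at 0 as well; it accounts for the `suc` in the bound.
  vanishing-on-powers⇒zero d p p≤N p≈0 with vanishing⇒zero (0# ∷ inflate d p)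
      (ℕ.≤-trans (s≤s (ℕ.≤-reflexive (length-inflate d p))) p≤N) vanishes
    where
    vanishes : ∀ y → eval (0# ∷ inflate d p) y ≈ 0#
    vanishes y with y ≟ 0#
    ... | yes y≈0 = trans (+-identityˡ _) (trans (*-congʳ y≈0) (zeroˡ _))
    ... | no y≉0 = trans (+-identityˡ _) (trans (*-congˡ (trans (eval-inflate d p y) (p≈0 y y≉0))) (zeroʳ _))
  ... | _ ∷ zeros = inflate-zero d p zeros

  -- Adding the two blocks of p is reduction modulo X^l - 1, which keeps the value at every u with
  -- u^l = 1. The remainder has at most l coefficients, few enough to be killed by vanishing at all
  -- nonzero (d+1)-st powers.
  vanishing⇒folded-coefficients : ∀ d l p → length p ≤ l +ℕ l → suc (l *ℕ suc d) ≤ N →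
    (∀ y → ¬ (y ≈ 0#) → ((y ^ᴷ suc d) ^ᴷ l ≈ 1#) × (eval p (y ^ᴷ suc d) ≈ 0#)) →
    ∀ {k} → k < l → coef p k + coef p (k +ℕ l) ≈ 0#
  vanishing⇒folded-coefficients d l p p≤2l l<N vanishes {k} k<l = begin
    coef p k + coef p (k +ℕ l)                ≈⟨ +-cong (reflexive (coef-take p k<l))
                                                  (reflexive (≡.trans (coef-drop l p k) (≡.cong (coef p) (ℕ.+-comm l k)))) ⟨
    coef (take l p) k + coef (drop l p) k     ≈⟨ coef-⊕ (take l p) (drop l p) k ⟨
    coef folded k                             ≈⟨ coef-zero (vanishing-on-powers⇒zero d folded folded≤N folded≈0) k ⟩
    0#                                        ∎
    where
    folded = take l p ⊕ drop l p
    folded≤l : length folded ≤ l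
    folded≤l = ℕ.≤-trans (ℕ.≤-reflexive (length-⊕ (take l p) (drop l p)))
      (ℕ.⊔-lub (ℕ.≤-trans (ℕ.≤-reflexive (length-take l p)) (ℕ.m⊓n≤m l _))
        (ℕ.≤-trans (ℕ.≤-reflexive (length-drop l p)) (ℕ.m≤n+o⇒m∸n≤o _ l p≤2l)))
    folded≤N : suc (length folded *ℕ suc d) ≤ N
    folded≤N = ℕ.≤-trans (s≤s (ℕ.*-monoˡ-≤ (suc d) folded≤l)) l<N
    folded≈0 : ∀ y → ¬ (y ≈ 0#) → eval folded (y ^ᴷ suc d) ≈ 0#
    folded≈0 y y≉0 = let u = y ^ᴷ suc d
                         uˡ≈1 , p≈0 = vanishes y y≉0 in begin
      eval folded u                                   ≈⟨ eval-⊕ (take l p) (drop l p) u ⟩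
      eval (take l p) u + eval (drop l p) u           ≈⟨ +-congˡ (trans (*-congʳ uˡ≈1) (*-identityˡ _)) ⟨
      eval (take l p) u + u ^ᴷ l * eval (drop l p) u  ≈⟨ eval-split l p u ⟨
      eval p u                                        ≈⟨ p≈0 ⟩
      0#                                              ∎

  square? : ∀ d → Dec (∃ λ w → w * w ≈ d)
  square? d = map′ (λ (i , e) → to i , e) (λ (w , e) → from w , trans (*-cong (to∘from w) (to∘from w)) e)
    (Fin.any? (λ i → to i * to i ≟ d))

  -- Of each pair {x, -x} the element coming first in the enumeration is squared
  -- and the other one sent to d times its square; this map is injective, hence onto.
  square-or-multiple : (∀ x → x ≈ - x → x ≈ 0#) → ∀ d → ¬ (∃ λ x → x * x ≈ d) →
    ∀ y → ∃ λ x → (x * x ≈ y) ⊎ (d * (x * x) ≈ y)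
  square-or-multiple x≈-x⇒x≈0 d d-nonsquare y with injective⇒strictlySurjective φ-injective (from y)
    where
    φ : Carrier → Carrier
    φ x with from x <? from (- x)
    ... | yes _ = x * x
    -- The element 0, the only one equal to its negative, lands here.
    ... | no _ = d * (x * x)
    d≉0 : ¬ (d ≈ 0#)
    d≉0 d≈0 = d-nonsquare (0# , trans (zeroˡ 0#) (sym d≈0))
    same-square : ∀ x y → x * x ≈ y * y → x ≈ y ⊎ x ≈ - y
    same-square x y e with x ≟ y
    ... | yes x≈y = inj₁ x≈y
    ... | no x≉y = inj₂ (x∙y⁻¹≈ε⇒x≈y x (- y) (xy≈0⇒y≈0 (λ e′ → x≉y (x∙y⁻¹≈ε⇒x≈y x y e′)) (begin
        (x - y) * (x - - y)             ≈⟨ *-congˡ (+-congˡ (-‿involutive y)) ⟩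
        (x - y) * (x + y)               ≈⟨ solve 3 (λ x m y → (x :+ m) :* (x :+ y) := (x :* x :+ y :* m) :+ x :* (m :+ y)) refl x (- y) y ⟩
        (x * x + y * - y) + x * (- y + y) ≈⟨ +-cong (+-cong e (sym (-‿distribʳ-* y y))) (trans (*-congˡ (-‿inverseˡ y)) (zeroʳ x)) ⟩
        (y * y - y * y) + 0#            ≈⟨ trans (+-identityʳ _) (-‿inverseʳ _) ⟩
        0#                              ∎)))
    from-neg : ∀ {x y} → x ≈ - y → from (- x) ≡ from y
    from-neg e = from-cong (trans (-‿cong e) (-‿involutive _))
    not-multiple : ∀ x y → from x Data.Fin.< from (- x) → ¬ (x * x ≈ d * (y * y))
    not-multiple x y x< e with y ≟ 0#
    ... | yes y≈0 = ℕ.<-irrefl (≡.cong toℕ (from-cong (trans x≈0 (sym (trans (-‿cong x≈0) -0#≈0#))))) x<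
      where
      x≈0 = ^≈0⇒≈0 2 (trans (*-congˡ (*-identityʳ x)) (trans e (trans (*-congˡ (trans (*-congˡ y≈0) (zeroʳ y))) (zeroʳ d))))
    ... | no y≉0 = d-nonsquare (x * (y ⁻¹) , (begin
        (x * (y ⁻¹)) * (x * (y ⁻¹))     ≈⟨ solve 2 (λ x z → (x :* z) :* (x :* z) := (x :* x) :* (z :* z)) refl x (y ⁻¹) ⟩
        (x * x) * ((y ⁻¹) * (y ⁻¹))     ≈⟨ *-congʳ e ⟩
        (d * (y * y)) * ((y ⁻¹) * (y ⁻¹)) ≈⟨ solve 3 (λ d y z → (d :* (y :* y)) :* (z :* z) := d :* ((y :* z) :* (y :* z))) refl d y (y ⁻¹) ⟩
        d * ((y * (y ⁻¹)) * (y * (y ⁻¹))) ≈⟨ *-congˡ (trans (*-cong (⁻¹-inv y y≉0) (⁻¹-inv y y≉0)) (*-identityˡ 1#)) ⟩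
        d * 1#                          ≈⟨ *-identityʳ d ⟩
        d                               ∎))
    φ-inj : ∀ x y → φ x ≈ φ y → x ≈ y
    φ-inj x y e with from x <? from (- x) | from y <? from (- y)
    ... | yes x< | no _ = contradiction e (not-multiple x y x<)
    ... | no _ | yes y< = contradiction (sym e) (not-multiple y x y<)
    ... | yes x< | yes y< with same-square x y e
    ...   | inj₁ x≈y = x≈y
    ...   | inj₂ x≈-y = contradiction
      (≡.subst₂ Data.Fin._<_ (from-cong x≈-y) (from-neg x≈-y) x<) (ℕ.<-asym y<)
    φ-inj x y e | no x≮ | no y≮ with same-square x y (*-cancelˡ d≉0 e)
    ...   | inj₁ x≈y = x≈y
    -- Both comparisons fail for x and y = - x, so x and - x have the same index and x = 0.
    ...   | inj₂ x≈-y = trans x≈0 (sym (trans y≈-x (trans (-‿cong x≈0) -0#≈0#)))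
      where
      y≈-x = sym (trans (-‿cong x≈-y) (-‿involutive y))
      x≈0 = x≈-x⇒x≈0 x (from-injective (Fin.toℕ-injective (ℕ.≤-antisym
        (≡.subst₂ (λ i j → toℕ i ≤ toℕ j) (≡.sym (from-cong x≈-y)) (≡.sym (from-neg x≈-y)) (ℕ.≮⇒≥ y≮))
        (ℕ.≮⇒≥ x≮))))
    φ-injective : Injective _≡_ _≡_ (λ i → from (φ (to i)))
    φ-injective {i} {j} e = ≡.trans (≡.sym (from∘to i))
      (≡.trans (from-cong (φ-inj (to i) (to j) (from-injective e))) (from∘to j))
  ... | i , e with from (to i) <? from (- (to i)) | from-injective e
  ...   | yes _ | e′ = to i , inj₁ e′
  ...   | no _ | e′ = to i , inj₂ e′

-- A ring solver for characteristic 3.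

module CharacteristicThree {c ℓ : Level} (K : CommutativeRing c ℓ) (3≈0 : HasCharacteristicThree K) where
  open CommutativeRing K hiding (zero)
  open RingProperties ring using (-‿involutive; -0#≈0#; -1*x≈-x)
  open GroupProperties +-group using (inverseʳ-unique)

  -- Coefficients for the solver: computing them modulo 3 lets it prove identities that fail in
  -- other characteristics.
  data ℤ₃ : Set where
    0̇ 1̇ -1̇ : ℤ₃

  ⟦_⟧ : ℤ₃ → Carrier
  ⟦ 0̇ ⟧ = 0#
  ⟦ 1̇ ⟧ = 1#
  ⟦ -1̇ ⟧ = - 1#

  infixl 6 _+̇_
  infixl 7 _*̇_
  _+̇_ _*̇_ : ℤ₃ → ℤ₃ → ℤ₃
  0̇ +̇ y = y
  1̇ +̇ 0̇ = 1̇
  1̇ +̇ 1̇ = -1̇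
  1̇ +̇ -1̇ = 0̇
  -1̇ +̇ 0̇ = -1̇
  -1̇ +̇ 1̇ = 0̇
  -1̇ +̇ -1̇ = 1̇

  -̇_ : ℤ₃ → ℤ₃
  -̇ 0̇ = 0̇
  -̇ 1̇ = -1̇
  -̇ -1̇ = 1̇

  0̇ *̇ y = 0̇
  1̇ *̇ y = y
  -1̇ *̇ y = -̇ y

  ℤ₃-rawRing : RawRing _ _
  ℤ₃-rawRing = record { Carrier = ℤ₃ ; _≈_ = _≡_ ; _+_ = _+̇_ ; _*_ = _*̇_ ; -_ = -̇_ ; 0# = 0̇ ; 1# = 1̇ }

  1+1≈-1 : 1# + 1# ≈ - 1#
  1+1≈-1 = inverseʳ-unique 1# (1# + 1#) 3≈0

  -1-1≈1 : - 1# + - 1# ≈ 1#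
  -1-1≈1 = trans (+-congˡ (sym 1+1≈-1)) (trans (sym (+-assoc _ _ _)) (trans (+-congʳ (-‿inverseˡ 1#)) (+-identityˡ 1#)))

  ⟦⟧-+ : ∀ x y → ⟦ x +̇ y ⟧ ≈ ⟦ x ⟧ + ⟦ y ⟧
  ⟦⟧-+ 0̇ y = sym (+-identityˡ _)
  ⟦⟧-+ 1̇ 0̇ = sym (+-identityʳ _)
  ⟦⟧-+ 1̇ 1̇ = sym 1+1≈-1
  ⟦⟧-+ 1̇ -1̇ = sym (-‿inverseʳ 1#)
  ⟦⟧-+ -1̇ 0̇ = sym (+-identityʳ _)
  ⟦⟧-+ -1̇ 1̇ = sym (-‿inverseˡ 1#)
  ⟦⟧-+ -1̇ -1̇ = sym -1-1≈1

  ⟦⟧-neg : ∀ x → ⟦ -̇ x ⟧ ≈ - ⟦ x ⟧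
  ⟦⟧-neg 0̇ = sym -0#≈0#
  ⟦⟧-neg 1̇ = refl
  ⟦⟧-neg -1̇ = sym (-‿involutive 1#)

  ⟦⟧-* : ∀ x y → ⟦ x *̇ y ⟧ ≈ ⟦ x ⟧ * ⟦ y ⟧
  ⟦⟧-* 0̇ y = sym (zeroˡ _)
  ⟦⟧-* 1̇ y = sym (*-identityˡ _)
  ⟦⟧-* -1̇ y = trans (⟦⟧-neg y) (sym (-1*x≈-x ⟦ y ⟧))

  ⟦⟧-homomorphism : ℤ₃-rawRing -Raw-AlmostCommutative⟶ fromCommutativeRing K
  ⟦⟧-homomorphism = record
    { ⟦_⟧ = ⟦_⟧ ; +-homo = ⟦⟧-+ ; *-homo = ⟦⟧-* ; -‿homo = ⟦⟧-neg ; 0-homo = refl ; 1-homo = refl }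

  _≟₃_ : ∀ x y → Maybe (⟦ x ⟧ ≈ ⟦ y ⟧)
  0̇ ≟₃ 0̇ = just refl
  1̇ ≟₃ 1̇ = just refl
  -1̇ ≟₃ -1̇ = just refl
  _ ≟₃ _ = nothing

  open Algebra.Solver.Ring ℤ₃-rawRing (fromCommutativeRing K) ⟦⟧-homomorphism _≟₃_ public
    using (solve; con; _:+_; _:*_; _:-_; :-_; _:=_)

-- Conjugation, the cubic of a fibre and its discriminant.

module Conjugation {c ℓ : Level} (K : CommutativeRing c ℓ) {N : ℕ} (FF : IsFiniteFieldOfOrder K N)
  (3≈0 : HasCharacteristicThree K)
  (bar : CommutativeRing.Carrier K → CommutativeRing.Carrier K) (involution : IsInvolution K bar)
  where
  open CommutativeRing K hiding (zero)
  open IsInvolution involution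
  open IsFiniteFieldOfOrder FF
  open FiniteField K FF
  open CharacteristicThree K 3≈0
  open GroupProperties +-group using (x∙y⁻¹≈ε⇒x≈y; x≈y⇒x∙y⁻¹≈ε; inverseˡ-unique; identityʳ-unique)
  open RingProperties ring using (-0#≈0#)
  open SetoidReasoning setoid

  -- For equations that hold modulo a known relation: z is the certificate, a multiple of that
  -- relation.
  ≈-modulo : ∀ {x y z} → z ≈ 0# → x - y ≈ z → x ≈ y
  ≈-modulo z≈0 e = x∙y⁻¹≈ε⇒x≈y _ _ (trans e z≈0)

  *0≈0 : ∀ {x} y → x ≈ 0# → y * x ≈ 0#
  *0≈0 y e = trans (*-congˡ e) (zeroʳ y)

  x≈-x⇒x≈0 : ∀ x → x ≈ - x → x ≈ 0#
  x≈-x⇒x≈0 x e = ≈-modulo (trans (-‿cong (x≈y⇒x∙y⁻¹≈ε e)) -0#≈0#) (solve 1 (λ x → x :- con 0̇ := :- (x :- :- x)) refl x)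

  bar-0 : bar 0# ≈ 0#
  bar-0 = identityʳ-unique (bar 0#) (bar 0#) (trans (sym (bar-+ 0# 0#)) (bar-cong (+-identityʳ 0#)))

  bar-neg : ∀ x → bar (- x) ≈ - bar x
  bar-neg x = inverseˡ-unique _ _ (trans (sym (bar-+ (- x) x)) (trans (bar-cong (-‿inverseˡ x)) bar-0))

  bar-- : ∀ x y → bar (x - y) ≈ bar x - bar y
  bar-- x y = trans (bar-+ x (- y)) (+-congˡ (bar-neg y))

  bar-≉0 : ∀ {x} → ¬ (x ≈ 0#) → ¬ (bar x ≈ 0#)
  bar-≉0 x≉0 e = x≉0 (trans (sym (bar-bar _)) (trans (bar-cong e) bar-0))

  bar-1 : bar 1# ≈ 1#
  bar-1 = *-cancelˡ (bar-≉0 1≉0) (trans (sym (bar-* 1# 1#)) (trans (bar-cong (*-identityʳ 1#)) (sym (*-identityʳ _))))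

  bar-cube : ∀ x → bar (x * (x * x)) ≈ bar x * (bar x * bar x)
  bar-cube x = trans (bar-* x (x * x)) (*-congˡ (bar-* x x))

  -- x x̄ f(x) for the trinomial f, as a cubic form in x and X = x̄.
  cubicForm : (a b x X : Carrier) → Carrier
  cubicForm a b x X = (a * (x * (x * x)) + (x * x) * X) + b * (X * (X * X))

  cubicForm-cong : ∀ a b {x X y Y} → x ≈ y → X ≈ Y → cubicForm a b x X ≈ cubicForm a b y Y
  cubicForm-cong a b e E = +-cong (+-cong (*-congˡ (*-cong e (*-cong e e))) (*-cong (*-cong e e) E)) (*-congˡ (*-cong E (*-cong E E)))

  bar-cubicForm : ∀ a b x X → bar (cubicForm a b x X) ≈ cubicForm (bar a) (bar b) (bar x) (bar X)
  bar-cubicForm a b x X = trans (bar-+ _ _) (+-cong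
    (trans (bar-+ _ _) (+-cong (trans (bar-* _ _) (*-congˡ (bar-cube x))) (trans (bar-* _ _) (*-congʳ (bar-* x x)))))
    (trans (bar-* _ _) (*-congˡ (bar-cube X))))

  module Discriminant (ε : Carrier) (ε≉0 : ¬ (ε ≈ 0#)) (bar-ε : bar ε ≈ - ε)
    (fixed⇒square : ∀ d → bar d ≈ d → ∃ λ w → w * w ≈ d)
    (a b : Carrier) (f : Carrier → Carrier)
    (norm-f : ∀ x → (x * bar x) * f x ≈ cubicForm a b x (bar x))
    (f-0 : ∀ {x} → x ≈ 0# → f x ≈ 0#)
    (f-injective : ∀ {x y} → f x ≈ f y → x ≈ y)
    where
    A = bar a
    B = bar b

    -- The discriminant of the cubic in the ratio of x and X that expresses f(x) ∈ 𝔽_q v.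
    discriminant : (v V : Carrier) → Carrier
    discriminant v V = ((v * V) * (v * V) + (v * V) * (a * (v * v) + A * (V * V)))
      - (B * ((v * v) * (v * v)) + b * ((V * V) * (V * V)))

    -- The cubic form scales by κ³ and the norm x x̄ by κ². Cancelling the norm needs κ ≠ 0, hence
    -- the case split.
    f-homogeneous : ∀ κ x → bar κ ≈ κ → ¬ (x ≈ 0#) → f (κ * x) ≈ κ * f x
    f-homogeneous κ x κ-fixed x≉0 with κ ≟ 0#
    ... | yes κ≈0 = trans (f-0 (trans (*-congʳ κ≈0) (zeroˡ x))) (sym (trans (*-congʳ κ≈0) (zeroˡ _)))
    ... | no κ≉0 = *-cancelˡ (*-≉0 z≉0 (bar-≉0 z≉0)) (begin
        (z * bar z) * f z                       ≈⟨ norm-f z ⟩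
        cubicForm a b z (bar z)                 ≈⟨ cubicForm-cong a b refl bar-z ⟩
        cubicForm a b (κ * x) (κ * bar x)       ≈⟨ solve 5 (λ a b κ x X →
            (a :* ((κ :* x) :* ((κ :* x) :* (κ :* x))) :+ ((κ :* x) :* (κ :* x)) :* (κ :* X)) :+ b :* ((κ :* X) :* ((κ :* X) :* (κ :* X)))
            := (κ :* (κ :* κ)) :* ((a :* (x :* (x :* x)) :+ (x :* x) :* X) :+ b :* (X :* (X :* X)))) refl a b κ x (bar x) ⟩
        (κ * (κ * κ)) * cubicForm a b x (bar x) ≈⟨ *-congˡ (norm-f x) ⟨
        (κ * (κ * κ)) * ((x * bar x) * f x)     ≈⟨ solve 4 (λ κ x X y → (κ :* (κ :* κ)) :* ((x :* X) :* y)
                                                     := ((κ :* x) :* (κ :* X)) :* (κ :* y)) refl κ x (bar x) (f x) ⟩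
        (z * (κ * bar x)) * (κ * f x)           ≈⟨ *-congʳ (*-congˡ bar-z) ⟨
        (z * bar z) * (κ * f x)                 ∎)
      where
      z = κ * x
      z≉0 = *-≉0 κ≉0 x≉0
      bar-z : bar z ≈ κ * bar x
      bar-z = trans (bar-* κ x) (*-congʳ κ-fixed)

    -- If f(y) ∈ 𝔽_q f(x) then y ∈ 𝔽_q x, by homogeneity and injectivity.
    parallel : ∀ {v x y} → ¬ (v ≈ 0#) → ¬ (x ≈ 0#) → ¬ (y ≈ 0#) → f x ≈ v →
      bar v * cubicForm a b y (bar y) ≈ v * cubicForm A B (bar y) y →
      ∃ λ κ → (bar κ ≈ κ) × (κ * x ≈ y)
    parallel {v} {x} {y} v≉0 x≉0 y≉0 fx≈v ∥ = κ , κ-fixed ,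
      f-injective (trans (f-homogeneous κ x κ-fixed x≉0) (trans (*-congˡ fx≈v) (sym fy≈κv)))
      where
      V = bar v
      Y = bar y
      V≉0 = bar-≉0 v≉0
      n≉0 = *-≉0 y≉0 (bar-≉0 y≉0)
      Fy = cubicForm a b y Y
      -- By `norm-f` this is f(y) / v.
      κ = Fy * ((v * (y * Y)) ⁻¹)
      κvn≈Fy : κ * (v * (y * Y)) ≈ Fy
      κvn≈Fy = trans (*-assoc _ _ _) (trans (*-congˡ (⁻¹-invˡ (*-≉0 v≉0 n≉0))) (*-identityʳ _))
      bar-Fy : bar Fy ≈ cubicForm A B Y y
      bar-Fy = trans (bar-cubicForm a b y Y) (cubicForm-cong A B refl (bar-bar y))
      barκVn≈barFy : bar κ * (V * (Y * y)) ≈ cubicForm A B Y y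
      barκVn≈barFy = begin
        bar κ * (V * (Y * y))          ≈⟨ *-congˡ (*-congˡ (*-congˡ (bar-bar y))) ⟨
        bar κ * (V * (Y * bar Y))      ≈⟨ *-congˡ (*-congˡ (bar-* y Y)) ⟨
        bar κ * (V * bar (y * Y))      ≈⟨ *-congˡ (bar-* v (y * Y)) ⟨
        bar κ * bar (v * (y * Y))      ≈⟨ bar-* κ _ ⟨
        bar (κ * (v * (y * Y)))        ≈⟨ bar-cong κvn≈Fy ⟩
        bar Fy                         ≈⟨ bar-Fy ⟩
        cubicForm A B Y y              ∎
      κ-fixed : bar κ ≈ κ
      κ-fixed = *-cancelˡ (*-≉0 (*-≉0 v≉0 V≉0) n≉0) (begin
        ((v * V) * (y * Y)) * bar κ    ≈⟨ solve 5 (λ v V y Y k → ((v :* V) :* (y :* Y)) :* k := v :* (k :* (V :* (Y :* y)))) refl v V y Y (bar κ) ⟩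
        v * (bar κ * (V * (Y * y)))    ≈⟨ *-congˡ barκVn≈barFy ⟩
        v * cubicForm A B Y y          ≈⟨ ∥ ⟨
        V * Fy                         ≈⟨ *-congˡ κvn≈Fy ⟨
        V * (κ * (v * (y * Y)))        ≈⟨ solve 5 (λ v V y Y k → V :* (k :* (v :* (y :* Y))) := ((v :* V) :* (y :* Y)) :* k) refl v V y Y κ ⟩
        ((v * V) * (y * Y)) * κ        ∎)
      fy≈κv : f y ≈ κ * v
      fy≈κv = *-cancelˡ n≉0 (trans (norm-f y) (trans (sym κvn≈Fy)
        (solve 3 (λ k v n → k :* (v :* n) := n :* (k :* v)) refl κ v (y * Y))))

    module Fibre (v x : Carrier) (v≉0 : ¬ (v ≈ 0#)) (fx≈v : f x ≈ v) where
      V = bar v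
      X = bar x

      x≉0 : ¬ (x ≈ 0#)
      x≉0 x≈0 = v≉0 (trans (sym fx≈v) (f-0 x≈0))

      -- With F the cubic form, y = x t and T the conjugate of t, V F(y) - v F̄(y) equals P t³ + R
      -- t² T - R̄ t T² - P̄ T³. This vanishes exactly when F(y) ∈ 𝔽_q v. Modulo `x-root`, the
      -- quadratic left after removing the root t = 1 has discriminant ε² U.
      P P̄ R R̄ S Δ U : Carrier
      P = (a * V - B * v) * (x * (x * x))
      P̄ = (A * v - b * V) * (X * (X * X))
      R = V * ((x * x) * X)
      R̄ = v * ((X * X) * x)
      S = R + R̄
      Δ = R - R̄
      U = R * R + P * S

      bar-R : bar R ≈ R̄
      bar-R = trans (bar-* _ _) (*-cong (bar-bar v) (trans (bar-* _ _) (*-cong (bar-* x x) (bar-bar x))))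

      bar-R̄ : bar R̄ ≈ R
      bar-R̄ = trans (bar-cong (sym bar-R)) (bar-bar R)

      bar-P : bar P ≈ P̄
      bar-P = trans (bar-* _ _) (*-cong (trans (bar-- _ _) (+-cong (trans (bar-* _ _) (*-congˡ (bar-bar v)))
        (-‿cong (trans (bar-* _ _) (*-congʳ (bar-bar b)))))) (bar-cube x))

      bar-S : bar S ≈ S
      bar-S = trans (bar-+ R R̄) (trans (+-cong bar-R bar-R̄) (+-comm R̄ R))

      bar-Δ : bar Δ ≈ - Δ
      bar-Δ = trans (bar-- R R̄) (trans (+-cong bar-R (-‿cong bar-R̄)) (solve 2 (λ r s → s :- r := :- (r :- s)) refl R R̄))

      -- The fibre cubic at t = T = 1, which vanishes because f(x) = v.
      x-root : (P - P̄) + (R - R̄) ≈ 0#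
      x-root = trans (solve 8 (λ a A b B v V x X →
          ((a :* V :- B :* v) :* (x :* (x :* x)) :- (A :* v :- b :* V) :* (X :* (X :* X))) :+ (V :* ((x :* x) :* X) :- v :* ((X :* X) :* x))
          := V :* (((a :* (x :* (x :* x)) :+ (x :* x) :* X) :+ b :* (X :* (X :* X))) :- (x :* X) :* v)
          :- v :* (((A :* (X :* (X :* X)) :+ (X :* X) :* x) :+ B :* (x :* (x :* x))) :- (X :* x) :* V)) refl a A b B v V x X)
        (trans (+-cong (*0≈0 V (x≈y⇒x∙y⁻¹≈ε (sym nv≈F))) (-‿cong (*0≈0 v (x≈y⇒x∙y⁻¹≈ε (sym nV≈F̄)))))
          (-‿inverseʳ 0#))
        where
        nv≈F : (x * X) * v ≈ cubicForm a b x X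
        nv≈F = trans (*-congˡ (sym fx≈v)) (norm-f x)
        nV≈F̄ : (X * x) * V ≈ cubicForm A B X x
        nV≈F̄ = trans (sym (trans (bar-* _ _) (*-congʳ (trans (bar-* x X) (*-congˡ (bar-bar x))))))
          (trans (bar-cong nv≈F) (trans (bar-cubicForm a b x X) (cubicForm-cong A B refl (bar-bar x))))

      -- The cubic of the fibre over 𝔽_q v has, besides x, no root x (s + ε) with s ∈ 𝔽_q;
      -- in s it is ε times the quadratic below.
      no-second-root : ∀ s → bar s ≈ s → ¬ ((S * (s * s) - (ε * Δ) * s) + (ε * ε) * ((P + P̄) - S) ≈ 0#)
      no-second-root s s-fixed G≈0 = ε≉0 (x≈-x⇒x≈0 ε ε≈-ε)
        where
        t = s + ε
        T = s - ε
        y = x * t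
        bar-t : bar t ≈ T
        bar-t = trans (bar-+ s ε) (+-cong s-fixed bar-ε)
        bar-y : bar y ≈ X * T
        bar-y = trans (bar-* x t) (*-congˡ bar-t)
        fixed⇒ε≈-ε : bar t ≈ t → ε ≈ - ε
        fixed⇒ε≈-ε e = sym (≈-modulo (x≈y⇒x∙y⁻¹≈ε (trans (sym bar-t) e)) (solve 2 (λ s ε → :- ε :- ε := (s :- ε) :- (s :+ ε)) refl s ε))
        t≉0 : ¬ (t ≈ 0#)
        t≉0 t≈0 = ε≉0 (x≈-x⇒x≈0 ε (fixed⇒ε≈-ε (trans (bar-cong t≈0) (trans bar-0 (sym t≈0)))))
        expand : V * cubicForm a b (x * t) (X * T) - v * cubicForm A B (X * T) (x * t)
          ≈ (P * (t * (t * t)) - P̄ * (T * (T * T))) + (R * ((t * t) * T) - R̄ * ((T * T) * t))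
        expand = solve 10 (λ a A b B v V x X t T →
          V :* ((a :* ((x :* t) :* ((x :* t) :* (x :* t))) :+ ((x :* t) :* (x :* t)) :* (X :* T)) :+ b :* ((X :* T) :* ((X :* T) :* (X :* T))))
          :- v :* ((A :* ((X :* T) :* ((X :* T) :* (X :* T))) :+ ((X :* T) :* (X :* T)) :* (x :* t)) :+ B :* ((x :* t) :* ((x :* t) :* (x :* t))))
          := (((a :* V :- B :* v) :* (x :* (x :* x))) :* (t :* (t :* t)) :- ((A :* v :- b :* V) :* (X :* (X :* X))) :* (T :* (T :* T)))
          :+ ((V :* ((x :* x) :* X)) :* ((t :* t) :* T) :- (v :* ((X :* X) :* x)) :* ((T :* T) :* t))) refl a A b B v V x X t T
        -- The root x sits at s = ∞, so removing it means that the coefficient of s³ is zero. Cubes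
        -- being additive, P and P̄ otherwise enter only the constant term.
        in-s : (P * (t * (t * t)) - P̄ * (T * (T * T))) + (R * ((t * t) * T) - R̄ * ((T * T) * t))
          ≈ (s * (s * s)) * ((P - P̄) + (R - R̄)) + ε * ((S * (s * s) - (ε * Δ) * s) + (ε * ε) * ((P + P̄) - S))
        in-s = solve 6 (λ p p̄ r r̄ s ε →
          (p :* ((s :+ ε) :* ((s :+ ε) :* (s :+ ε))) :- p̄ :* ((s :- ε) :* ((s :- ε) :* (s :- ε))))
          :+ (r :* (((s :+ ε) :* (s :+ ε)) :* (s :- ε)) :- r̄ :* (((s :- ε) :* (s :- ε)) :* (s :+ ε)))
          := (s :* (s :* s)) :* ((p :- p̄) :+ (r :- r̄))
          :+ ε :* (((r :+ r̄) :* (s :* s) :- (ε :* (r :- r̄)) :* s) :+ (ε :* ε) :* ((p :+ p̄) :- (r :+ r̄)))) refl P P̄ R R̄ s ε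
        second : ∃ λ κ → (bar κ ≈ κ) × (κ * x ≈ y)
        second = parallel v≉0 x≉0 (*-≉0 x≉0 t≉0) fx≈v (begin
          V * cubicForm a b y (bar y)          ≈⟨ *-congˡ (cubicForm-cong a b refl bar-y) ⟩
          V * cubicForm a b y (X * T)          ≈⟨ x∙y⁻¹≈ε⇒x≈y _ _ (trans expand (trans in-s
                                                    (trans (+-cong (*0≈0 _ x-root) (*0≈0 ε G≈0)) (+-identityʳ 0#)))) ⟩
          v * cubicForm A B (X * T) y          ≈⟨ *-congˡ (cubicForm-cong A B bar-y refl) ⟨
          v * cubicForm A B (bar y) y          ∎)
        ε≈-ε : ε ≈ - ε
        ε≈-ε = let κ , κ-fixed , κx≈y = second
                   t≈κ = *-cancelˡ x≉0 (trans (sym κx≈y) (*-comm κ x))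
               in fixed⇒ε≈-ε (trans (bar-cong t≈κ) (trans κ-fixed (sym t≈κ)))

      R≉0 : ¬ (R ≈ 0#)
      R≉0 = *-≉0 (bar-≉0 v≉0) (*-≉0 (*-≉0 x≉0 x≉0) (bar-≉0 x≉0))

      -- Otherwise the quadratic degenerates to a linear polynomial of slope - ε Δ, which has a root
      -- in 𝔽_q: Δ is nonzero because R = - (S + Δ) is.
      S≉0 : ¬ (S ≈ 0#)
      S≉0 S≈0 = no-second-root s s-fixed (begin
          (S * (s * s) - (ε * Δ) * s) + (ε * ε) * ((P + P̄) - S)
            ≈⟨ solve 6 (λ S s ε Δ p p̄ → (S :* (s :* s) :- (ε :* Δ) :* s) :+ (ε :* ε) :* ((p :+ p̄) :- S)
                 := (s :* s :- ε :* ε) :* S :+ ((ε :* ε) :* (p :+ p̄) :- ε :* (Δ :* s))) refl S s ε Δ P P̄ ⟩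
          (s * s - ε * ε) * S + ((ε * ε) * (P + P̄) - ε * (Δ * s))
            ≈⟨ +-cong (*0≈0 _ S≈0) (+-congˡ (-‿cong (*-congˡ Δs≈))) ⟩
          0# + ((ε * ε) * (P + P̄) - ε * (ε * (P + P̄)))
            ≈⟨ solve 2 (λ ε p → con 0̇ :+ ((ε :* ε) :* p :- ε :* (ε :* p)) := con 0̇) refl ε (P + P̄) ⟩
          0# ∎)
        where
        s = (ε * (P + P̄)) * (Δ ⁻¹)
        Δ≉0 : ¬ (Δ ≈ 0#)
        Δ≉0 Δ≈0 = R≉0 (≈-modulo (trans (-‿cong (trans (+-cong S≈0 Δ≈0) (+-identityʳ 0#))) -0#≈0#)
          (solve 2 (λ r r̄ → r :- con 0̇ := :- ((r :+ r̄) :+ (r :- r̄))) refl R R̄))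
        Δs≈ : Δ * s ≈ ε * (P + P̄)
        Δs≈ = trans (*-comm _ _) (trans (*-assoc _ _ _) (trans (*-congˡ (⁻¹-invˡ Δ≉0)) (*-identityʳ _)))
        bar-P+P̄ : bar (P + P̄) ≈ P + P̄
        bar-P+P̄ = trans (bar-+ P P̄) (trans (+-cong bar-P (trans (bar-cong (sym bar-P)) (bar-bar P))) (+-comm P̄ P))
        s-fixed : bar s ≈ s
        s-fixed = *-cancelˡ Δ≉0 (begin
          Δ * bar s          ≈⟨ solve 2 (λ d s → d :* s := :- (:- d :* s)) refl Δ (bar s) ⟩
          - (- Δ * bar s)    ≈⟨ -‿cong (*-congʳ bar-Δ) ⟨
          - (bar Δ * bar s)  ≈⟨ -‿cong (bar-* Δ s) ⟨
          - bar (Δ * s)      ≈⟨ -‿cong (bar-cong Δs≈) ⟩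
          - bar (ε * (P + P̄)) ≈⟨ -‿cong (trans (bar-* ε _) (*-cong bar-ε bar-P+P̄)) ⟩
          - (- ε * (P + P̄))  ≈⟨ solve 2 (λ e p → :- (:- e :* p) := e :* p) refl ε (P + P̄) ⟩
          ε * (P + P̄)        ≈⟨ Δs≈ ⟨
          Δ * s              ∎)

      -- Conjugation turns R² + P S into R̄² + P̄ S; the difference is a multiple of `x-root`.
      U-fixed : bar U ≈ U
      U-fixed = trans (trans (bar-+ _ _) (+-cong (trans (bar-* R R) (*-cong bar-R bar-R)) (trans (bar-* P S) (*-cong bar-P bar-S))))
        (≈-modulo (trans (-‿cong (*0≈0 S x-root)) -0#≈0#)
          (solve 4 (λ p p̄ r r̄ → (r̄ :* r̄ :+ p̄ :* (r :+ r̄)) :- (r :* r :+ p :* (r :+ r̄))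
            := :- ((r :+ r̄) :* ((p :- p̄) :+ (r :- r̄)))) refl P P̄ R R̄))

      -- The quadratic formula: ε w would lie in 𝔽_q, and s = - ε (Δ + w) / S, where 1/2 = -1, would
      -- be a root there.
      root-not-anti-fixed : ∀ {w} → w * w ≈ U → ¬ (bar w ≈ - w)
      root-not-anti-fixed {w} w²≈U w-anti = no-second-root s s-fixed (xy≈0⇒y≈0 S≉0 (begin
          S * ((S * (s * s) - (ε * Δ) * s) + (ε * ε) * ((P + P̄) - S))
            ≈⟨ solve 6 (λ S s ε Δ p p̄ → S :* ((S :* (s :* s) :- (ε :* Δ) :* s) :+ (ε :* ε) :* ((p :+ p̄) :- S))
                 := ((S :* s) :* (S :* s) :- (ε :* Δ) :* (S :* s)) :+ (ε :* ε) :* (S :* ((p :+ p̄) :- S))) refl S s ε Δ P P̄ ⟩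
          ((S * s) * (S * s) - (ε * Δ) * (S * s)) + (ε * ε) * (S * ((P + P̄) - S))
            ≈⟨ +-congʳ (+-cong (*-cong Ss≈ Ss≈) (-‿cong (*-congˡ Ss≈))) ⟩
          (e * e - (ε * Δ) * e) + (ε * ε) * (S * ((P + P̄) - S))
            ≈⟨ solve 6 (λ w ε p p̄ r r̄ →
                 ((:- (ε :* ((r :- r̄) :+ w))) :* (:- (ε :* ((r :- r̄) :+ w))) :- (ε :* (r :- r̄)) :* (:- (ε :* ((r :- r̄) :+ w))))
                 :+ (ε :* ε) :* ((r :+ r̄) :* ((p :+ p̄) :- (r :+ r̄)))
                 := (ε :* ε) :* (w :* w :- (r :* r :+ p :* (r :+ r̄)))
                 :- ((ε :* ε) :* (r :+ r̄)) :* ((p :- p̄) :+ (r :- r̄))) refl w ε P P̄ R R̄ ⟩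
          (ε * ε) * (w * w - U) - ((ε * ε) * S) * ((P - P̄) + (R - R̄))
            ≈⟨ +-cong (*0≈0 _ (x≈y⇒x∙y⁻¹≈ε w²≈U)) (-‿cong (*0≈0 _ x-root)) ⟩
          0# - 0#
            ≈⟨ -‿inverseʳ 0# ⟩
          0# ∎))
        where
        e = - (ε * (Δ + w))
        s = e * (S ⁻¹)
        Ss≈ : S * s ≈ e
        Ss≈ = trans (*-comm _ _) (trans (*-assoc _ _ _) (trans (*-congˡ (⁻¹-invˡ S≉0)) (*-identityʳ _)))
        bar-e : bar e ≈ e
        bar-e = trans (bar-neg _) (trans (-‿cong (trans (bar-* _ _) (*-cong bar-ε (trans (bar-+ Δ w) (+-cong bar-Δ w-anti)))))
          (solve 3 (λ ε d w → :- (:- ε :* (:- d :+ :- w)) := :- (ε :* (d :+ w))) refl ε Δ w))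
        s-fixed : bar s ≈ s
        s-fixed = *-cancelˡ S≉0 (trans (*-congʳ (sym bar-S)) (trans (sym (bar-* S s)) (trans (bar-cong Ss≈) (trans bar-e (sym Ss≈)))))

      n³ : Carrier
      n³ = (x * X) * ((x * X) * (x * X))

      -- In characteristic 3 the binary cubic has discriminant (R R̄)² + P R̄³ + P̄ R³. As R R̄ = v
      -- V n³, the choice of x enters it only through the factor n³ squared; modulo `x-root` it is
      -- also S² U.
      discriminant-scaled : (n³ * n³) * discriminant v V ≈ (S * S) * U
      discriminant-scaled = trans
        (solve 8 (λ a A b B v V x X →
          (((x :* X) :* ((x :* X) :* (x :* X))) :* ((x :* X) :* ((x :* X) :* (x :* X)))) :*
            (((v :* V) :* (v :* V) :+ (v :* V) :* (a :* (v :* v) :+ A :* (V :* V)))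
              :- (B :* ((v :* v) :* (v :* v)) :+ b :* ((V :* V) :* (V :* V))))
          := (let r = V :* ((x :* x) :* X); r̄ = v :* ((X :* X) :* x)
                  p = (a :* V :- B :* v) :* (x :* (x :* x)); p̄ = (A :* v :- b :* V) :* (X :* (X :* X))
              in ((r :* r̄) :* (r :* r̄) :+ p :* (r̄ :* (r̄ :* r̄))) :+ p̄ :* (r :* (r :* r)))) refl a A b B v V x X)
        (≈-modulo (trans (-‿cong (*0≈0 _ x-root)) -0#≈0#)
          (solve 4 (λ p p̄ r r̄ →
            (((r :* r̄) :* (r :* r̄) :+ p :* (r̄ :* (r̄ :* r̄))) :+ p̄ :* (r :* (r :* r)))
              :- ((r :+ r̄) :* (r :+ r̄)) :* (r :* r :+ p :* (r :+ r̄))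
            := :- ((r :* (r :* r)) :* ((p :- p̄) :+ (r :- r̄)))) refl P P̄ R R̄))

      n³≉0 : ¬ (n³ ≈ 0#)
      n³≉0 = *-≉0 n≉0 (*-≉0 n≉0 n≉0)
        where n≉0 = *-≉0 x≉0 (bar-≉0 x≉0)

      discriminant-square : ∃ λ W → (bar W ≈ W) × ¬ (W ≈ 0#) × (W * W ≈ discriminant v V)
      discriminant-square = W , W-fixed , W≉0 , W²≈D
        where
        square = fixed⇒square U U-fixed
        w = proj₁ square
        w²≈U = proj₂ square
        -- As w² is fixed, w̄ = ± w.
        w-fixed : bar w ≈ w
        w-fixed = [ x∙y⁻¹≈ε⇒x≈y (bar w) w , (λ e → contradiction (inverseˡ-unique _ _ e) (root-not-anti-fixed w²≈U)) ]′
          (xy≈0⇒x≈0∨y≈0 (trans (solve 2 (λ u w → (u :- w) :* (u :+ w) := u :* u :- w :* w) refl (bar w) w)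
            (x≈y⇒x∙y⁻¹≈ε (trans (sym (bar-* w w)) (trans (bar-cong w²≈U) (trans U-fixed (sym w²≈U)))))))
        -- Zero is anti-fixed too, so the same lemma excludes U = 0.
        w≉0 : ¬ (w ≈ 0#)
        w≉0 w≈0 = root-not-anti-fixed w²≈U (trans w-fixed (trans w≈0 (sym (trans (-‿cong w≈0) -0#≈0#))))
        W = (S * w) * (n³ ⁻¹)
        n³W≈Sw : n³ * W ≈ S * w
        n³W≈Sw = trans (*-comm _ _) (trans (*-assoc _ _ _) (trans (*-congˡ (⁻¹-invˡ n³≉0)) (*-identityʳ _)))
        W≉0 : ¬ (W ≈ 0#)
        W≉0 = *-≉0 (*-≉0 S≉0 w≉0) (⁻¹-≉0 n³≉0)
        bar-n³ : bar n³ ≈ n³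
        bar-n³ = trans (bar-cube _) (*-cong n-fixed (*-cong n-fixed n-fixed))
          where n-fixed = trans (bar-* x X) (trans (*-congˡ (bar-bar x)) (*-comm X x))
        W-fixed : bar W ≈ W
        W-fixed = *-cancelˡ n³≉0 (trans (*-congʳ (sym bar-n³)) (trans (sym (bar-* n³ W)) (trans (bar-cong n³W≈Sw)
          (trans (bar-* S w) (trans (*-cong bar-S w-fixed) (sym n³W≈Sw))))))
        W²≈D : W * W ≈ discriminant v V
        W²≈D = *-cancelˡ (*-≉0 n³≉0 n³≉0) (begin
          (n³ * n³) * (W * W)      ≈⟨ solve 2 (λ n w → (n :* n) :* (w :* w) := (n :* w) :* (n :* w)) refl n³ W ⟩
          (n³ * W) * (n³ * W)      ≈⟨ *-cong n³W≈Sw n³W≈Sw ⟩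
          (S * w) * (S * w)        ≈⟨ solve 2 (λ s w → (s :* w) :* (s :* w) := (s :* s) :* (w :* w)) refl S w ⟩
          (S * S) * (w * w)        ≈⟨ *-congˡ w²≈U ⟩
          (S * S) * U              ≈⟨ discriminant-scaled ⟨
          (n³ * n³) * discriminant v V ∎)

  -- With E = a ā - b b̄ the hypothesis reads ā b̄ = - a E, which turns the right-hand side for W²
  -- into L² / (a ā E) for L = a ā + ā b̄ + a b; so L / (a ā W) is the required y.
  norm-ratio-square : ∀ {a b W} (let A = bar a) (let B = bar b) → ¬ (a ≈ 0#) → ¬ (b ≈ 0#) →
    A * B ≈ a * (b * B - a * A) →
    bar W ≈ W → ¬ (W ≈ 0#) → W * W ≈ (1# + (a + A)) - (B + b) →
    ∃ λ y → (bar y ≈ y) × ¬ (y ≈ 0#) × ((a * A) * (y * y) ≈ a * A - b * B)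
  norm-ratio-square {a} {b} {W} a≉0 b≉0 AB≈ W-fixed W≉0 W²≈ = y , y-fixed , y≉0 , ny²≈E
    where
    A = bar a
    B = bar b
    n = a * A
    E = n - b * B
    L = (n + A * B) + a * b
    n≉0 = *-≉0 a≉0 (bar-≉0 a≉0)
    bar-n : bar n ≈ n
    bar-n = trans (bar-* a A) (trans (*-congˡ (bar-bar a)) (*-comm A a))
    bar-bB : bar (b * B) ≈ b * B
    bar-bB = trans (bar-* b B) (trans (*-congˡ (bar-bar b)) (*-comm B b))
    AB≈-aE : A * B ≈ - (a * E)
    AB≈-aE = trans AB≈ (solve 3 (λ a n m → a :* (m :- n) := :- (a :* (n :- m))) refl a n (b * B))
    ab≈-AE : a * b ≈ - (A * E)
    ab≈-AE = begin
      a * b            ≈⟨ *-cong (bar-bar a) (bar-bar b) ⟨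
      bar A * bar B    ≈⟨ bar-* A B ⟨
      bar (A * B)      ≈⟨ bar-cong AB≈-aE ⟩
      bar (- (a * E))  ≈⟨ trans (bar-neg _) (-‿cong (trans (bar-* a E) (*-congˡ (trans (bar-- n (b * B)) (+-cong bar-n (-‿cong bar-bB)))))) ⟩
      - (A * E)        ∎
    -- The hypothesis multiplied by its conjugate.
    bB≈E² : b * B ≈ E * E
    bB≈E² = *-cancelˡ n≉0 (begin
      n * (b * B)                  ≈⟨ solve 4 (λ a A b B → (a :* A) :* (b :* B) := (A :* B) :* (a :* b)) refl a A b B ⟩
      (A * B) * (a * b)            ≈⟨ *-cong AB≈-aE ab≈-AE ⟩
      - (a * E) * - (A * E)        ≈⟨ solve 3 (λ a A e → (:- (a :* e)) :* (:- (A :* e)) := (a :* A) :* (e :* e)) refl a A E ⟩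
      n * (E * E)                  ∎)
    n≈E+E² : n ≈ E + E * E
    n≈E+E² = trans (solve 2 (λ n m → n := (n :- m) :+ m) refl n (b * B)) (+-congˡ bB≈E²)
    L² : L * L ≈ (n * E) * (W * W)
    L² = begin
      L * L
        ≈⟨ *-cong L≈ L≈ ⟩
      ((n + - (a * E)) + - (A * E)) * ((n + - (a * E)) + - (A * E))
        ≈⟨ ≈-modulo (*0≈0 n (x≈y⇒x∙y⁻¹≈ε n≈E+E²)) (solve 3 (λ a A E →
             (((a :* A) :+ :- (a :* E)) :+ :- (A :* E)) :* (((a :* A) :+ :- (a :* E)) :+ :- (A :* E))
             :- (((a :* A) :* E :* (con 1̇ :+ (a :+ A)) :- (a :* E) :* (:- (a :* E))) :- (A :* E) :* (:- (A :* E)))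
             := (a :* A) :* ((a :* A) :- (E :+ E :* E))) refl a A E) ⟩
      (n * E * (1# + (a + A)) - (a * E) * - (a * E)) - (A * E) * - (A * E)
        ≈⟨ +-cong (+-congˡ (-‿cong (*-congˡ (sym AB≈-aE)))) (-‿cong (*-congˡ (sym ab≈-AE))) ⟩
      (n * E * (1# + (a + A)) - (a * E) * (A * B)) - (A * E) * (a * b)
        ≈⟨ solve 5 (λ a A b B E → ((a :* A) :* E :* (con 1̇ :+ (a :+ A)) :- (a :* E) :* (A :* B)) :- (A :* E) :* (a :* b)
             := ((a :* A) :* E) :* ((con 1̇ :+ (a :+ A)) :- (B :+ b))) refl a A b B E ⟩
      (n * E) * ((1# + (a + A)) - (B + b))
        ≈⟨ *-congˡ W²≈ ⟨
      (n * E) * (W * W) ∎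
      where
      L≈ : L ≈ (n + - (a * E)) + - (A * E)
      L≈ = +-cong (+-congˡ AB≈-aE) ab≈-AE
    nW≉0 = *-≉0 n≉0 W≉0
    y = L * ((n * W) ⁻¹)
    nWy≈L : (n * W) * y ≈ L
    nWy≈L = trans (*-comm _ _) (trans (*-assoc _ _ _) (trans (*-congˡ (⁻¹-invˡ nW≉0)) (*-identityʳ _)))
    bar-L : bar L ≈ L
    bar-L = trans (bar-+ _ _) (trans (+-cong (trans (bar-+ _ _) (+-cong bar-n (trans (bar-* A B) (*-cong (bar-bar a) (bar-bar b))))) (bar-* a b))
      (solve 3 (λ n s t → (n :+ s) :+ t := (n :+ t) :+ s) refl n (a * b) (A * B)))
    y-fixed : bar y ≈ y
    y-fixed = *-cancelˡ nW≉0 (trans (*-congʳ (sym (trans (bar-* n W) (*-cong bar-n W-fixed))))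
      (trans (sym (bar-* (n * W) y)) (trans (bar-cong nWy≈L) (trans bar-L (sym nWy≈L)))))
    ny²≈E : n * (y * y) ≈ E
    ny²≈E = *-cancelˡ (*-≉0 n≉0 (*-≉0 W≉0 W≉0)) (begin
      (n * (W * W)) * (n * (y * y))  ≈⟨ solve 3 (λ n w y → (n :* (w :* w)) :* (n :* (y :* y)) := ((n :* w) :* y) :* ((n :* w) :* y)) refl n W y ⟩
      ((n * W) * y) * ((n * W) * y)  ≈⟨ *-cong nWy≈L nWy≈L ⟩
      L * L                          ≈⟨ L² ⟩
      (n * E) * (W * W)              ≈⟨ solve 3 (λ n w e → (n :* e) :* (w :* w) := (n :* (w :* w)) :* e) refl n W E ⟩
      (n * (W * W)) * E              ∎)
    -- From y = 0 would follow E = 0, and then A B = - a E = 0.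
    y≉0 : ¬ (y ≈ 0#)
    y≉0 y≈0 = *-≉0 (bar-≉0 a≉0) (bar-≉0 b≉0) (trans AB≈-aE (trans (-‿cong (*0≈0 a (trans (sym ny²≈E) (*0≈0 n (*0≈0 y y≈0))))) -0#≈0#))

-- The five-term recurrence P (X (Pᵐ)′) = m X P′ Pᵐ, read at X, X^(q+2) and X^(q+3) with m = 1 in K,
-- eliminates the unknown coefficients of Pᵐ.
module CoefficientRelations {c ℓ : Level} (K : CommutativeRing c ℓ)
  (3≈0 : HasCharacteristicThree K)
  (r m : ℕ) (q×≈0 : Annihilates K (3 +ℕ r)) (m×1≈1 : IsOne K m) (a A b B : CommutativeRing.Carrier K)
  where
  open CommutativeRing K hiding (zero)
  open Polynomials K
  open CharacteristicThree K 3≈0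
  open GroupProperties +-group using (x∙y⁻¹≈ε⇒x≈y; x≈y⇒x∙y⁻¹≈ε; inverseˡ-unique; inverseʳ-unique)
  open SetoidReasoning setoid

  quartic : List Carrier
  quartic = - B ∷ a ∷ 1# ∷ A ∷ - b ∷ []

  C : ℕ → Carrier
  C = coef (power quartic m)

  recurrence : ∀ k → (quartic · θ C) k ≈ (δ quartic · C) k
  recurrence k = trans (power-rule quartic m k) (trans (*-congʳ m×1≈1) (*-identityˡ _))

  -- Since q = 3 + r is zero in K, θ multiplies C(i + r) by i modulo 3; the same holds for the next
  -- four.
  θ-6+r : θ C (6 +ℕ r) ≈ 0#
  θ-6+r = trans (+-congˡ (+-congˡ (+-congˡ (q×≈0 _)))) (solve 1 (λ x → x :+ (x :+ (x :+ con 0̇)) := con 0̇) refl _)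

  θ-5+r : θ C (5 +ℕ r) ≈ - C (5 +ℕ r)
  θ-5+r = trans (+-congˡ (+-congˡ (q×≈0 _))) (solve 1 (λ x → x :+ (x :+ con 0̇) := :- x) refl _)

  θ-4+r : θ C (4 +ℕ r) ≈ C (4 +ℕ r)
  θ-4+r = trans (+-congˡ (q×≈0 _)) (+-identityʳ _)

  θ-2+r : θ C (2 +ℕ r) ≈ - C (2 +ℕ r)
  θ-2+r = inverseʳ-unique _ _ (q×≈0 _)

  θ-1+r : θ C (1 +ℕ r) ≈ C (1 +ℕ r)
  θ-1+r = trans (inverseʳ-unique _ _ (trans (+-assoc _ _ _) (q×≈0 _))) (solve 1 (λ x → :- (x :+ x) := x) refl _)

  five-terms : ∀ (f : ℕ → Carrier) k {t₀ t₁ t₂ t₃ t₄} →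
    f (5 +ℕ k) ≈ t₀ → f (4 +ℕ k) ≈ t₁ → f (3 +ℕ k) ≈ t₂ → f (2 +ℕ k) ≈ t₃ → f (1 +ℕ k) ≈ t₄ →
    (quartic · f) (5 +ℕ k) ≈ (- B * t₀ + (a * t₁ + (1# * t₂ + (A * t₃ + (- b * t₄ + 0#)))))
  five-terms f k e₀ e₁ e₂ e₃ e₄ =
    +-cong (*-congˡ e₀) (+-cong (*-congˡ e₁) (+-cong (*-congˡ e₂) (+-cong (*-congˡ e₃) (+-congʳ (*-congˡ e₄)))))

  relation₁ : - B * C 1 ≈ a * C 0
  relation₁ = begin
    - B * C 1                                   ≈⟨ solve 3 (λ b a x → b :* x := b :* (x :+ con 0̇) :+ (a :* con 0̇ :+ con 0̇)) refl (- B) a (C 1) ⟩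
    (quartic · θ C) 1                           ≈⟨ recurrence 1 ⟩
    (δ quartic · C) 1                           ≈⟨ solve 3 (λ a x y → con 0̇ :* x :+ ((a :+ con 0̇) :* y :+ con 0̇) := a :* y) refl a (C 1) (C 0) ⟩
    a * C 0                                     ∎

  -- At index q + 2 the terms in C(q+1) and C(q-2) agree on both sides modulo 3 and cancel.
  relation₂ : B * C (5 +ℕ r) ≈ A * C (2 +ℕ r) - C (3 +ℕ r)
  relation₂ = x∙y⁻¹≈ε⇒x≈y _ _ (trans
    (solve 9 (λ a A b B g₋₁ g₀ g₁ g₂ g₃ → B :* g₃ :- (A :* g₀ :- g₁)
      := (:- B :* (:- g₃) :+ (a :* g₂ :+ (con 1̇ :* con 0̇ :+ (A :* (:- g₀) :+ (:- b :* g₋₁ :+ con 0̇)))))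
      :- (con 0̇ :* g₃ :+ ((a :+ con 0̇) :* g₂ :+ ((con 1̇ :+ (con 1̇ :+ con 0̇)) :* g₁ :+ ((A :+ (A :+ (A :+ con 0̇))) :* g₀
        :+ ((:- b :+ (:- b :+ (:- b :+ (:- b :+ con 0̇)))) :* g₋₁ :+ con 0̇))))))
      refl a A b B (C (1 +ℕ r)) (C (2 +ℕ r)) (C (3 +ℕ r)) (C (4 +ℕ r)) (C (5 +ℕ r)))
    (x≈y⇒x∙y⁻¹≈ε (trans (sym (five-terms (θ C) r θ-5+r θ-4+r (q×≈0 _) θ-2+r θ-1+r)) (recurrence (5 +ℕ r)))))

  -- At index q + 3 the terms in C(q+3) and C(q) are zero on both sides.
  relation₃ : a * C (5 +ℕ r) ≈ C (4 +ℕ r) + b * C (2 +ℕ r)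
  relation₃ = x∙y⁻¹≈ε⇒x≈y _ _ (trans
    (solve 9 (λ a A b B g₀ g₁ g₂ g₃ g₄ → a :* g₃ :- (g₂ :+ b :* g₀)
      := (:- B :* con 0̇ :+ (a :* (:- g₃) :+ (con 1̇ :* g₂ :+ (A :* con 0̇ :+ (:- b :* (:- g₀) :+ con 0̇)))))
      :- (con 0̇ :* g₄ :+ ((a :+ con 0̇) :* g₃ :+ ((con 1̇ :+ (con 1̇ :+ con 0̇)) :* g₂ :+ ((A :+ (A :+ (A :+ con 0̇))) :* g₁
        :+ ((:- b :+ (:- b :+ (:- b :+ (:- b :+ con 0̇)))) :* g₀ :+ con 0̇))))))
      refl a A b B (C (2 +ℕ r)) (C (3 +ℕ r)) (C (4 +ℕ r)) (C (5 +ℕ r)) (C (6 +ℕ r)))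
    (x≈y⇒x∙y⁻¹≈ε (trans (sym (five-terms (θ C) (1 +ℕ r) θ-6+r θ-5+r θ-4+r (q×≈0 _) θ-2+r)) (recurrence (6 +ℕ r)))))

  elimination : C (2 +ℕ r) ≈ 1# → C (3 +ℕ r) ≈ 0# → C 0 + C (4 +ℕ r) ≈ 0# → C 1 + C (5 +ℕ r) ≈ 0# →
    A * B ≈ a * (b * B - a * A)
  elimination g₀≈1 g₁≈0 C₀+g₂≈0 C₁+g₃≈0 = begin
    A * B                                 ≈⟨ *-congʳ A≈Bg₃ ⟩
    (B * g₃) * B                          ≈⟨ *-congʳ Bg₃≈-ag₂ ⟩
    - (a * g₂) * B                        ≈⟨ *-congʳ (-‿cong (*-congˡ g₂≈)) ⟩
    - (a * (a * g₃ - b)) * B              ≈⟨ solve 4 (λ a b B g → (:- (a :* (a :* g :- b))) :* B := a :* (b :* B :- a :* (B :* g))) refl a b B g₃ ⟩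
    a * (b * B - a * (B * g₃))            ≈⟨ *-congˡ (+-congˡ (-‿cong (*-congˡ A≈Bg₃))) ⟨
    a * (b * B - a * A)                   ∎
    where
    g₂ = C (4 +ℕ r)
    g₃ = C (5 +ℕ r)
    A≈Bg₃ : A ≈ B * g₃
    A≈Bg₃ = sym (trans relation₂ (trans (+-cong (*-congˡ g₀≈1) (-‿cong g₁≈0)) (solve 1 (λ A → A :* con 1̇ :- con 0̇ := A) refl A)))
    g₂≈ : g₂ ≈ a * g₃ - b
    g₂≈ = sym (trans (+-congʳ (trans relation₃ (+-congˡ (*-congˡ g₀≈1)))) (solve 2 (λ g b → (g :+ b :* con 1̇) :- b := g) refl g₂ b))
    Bg₃≈-ag₂ : B * g₃ ≈ - (a * g₂)
    Bg₃≈-ag₂ = begin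
      B * g₃          ≈⟨ *-congˡ (inverseʳ-unique _ _ C₁+g₃≈0) ⟩
      B * - C 1       ≈⟨ solve 2 (λ b x → b :* (:- x) := :- b :* x) refl B (C 1) ⟩
      - B * C 1       ≈⟨ relation₁ ⟩
      a * C 0         ≈⟨ *-congˡ (inverseˡ-unique _ _ C₀+g₂≈0) ⟩
      a * - g₂        ≈⟨ solve 2 (λ a x → a :* (:- x) := :- (a :* x)) refl a g₂ ⟩
      - (a * g₂)      ∎

-- The field of order q² for q = 2m + 1.

odd-square : ∀ m → suc (m +ℕ m) *ℕ suc (m +ℕ m) ≡ suc ((m +ℕ m) *ℕ suc m +ℕ (m +ℕ m) *ℕ suc m)
odd-square = ℕ-solve 1 (λ m → (ℕcon 1 ℕ:+ (m ℕ:+ m)) ℕ:* (ℕcon 1 ℕ:+ (m ℕ:+ m))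
  ℕ:= ℕcon 1 ℕ:+ ((m ℕ:+ m) ℕ:* (ℕcon 1 ℕ:+ m) ℕ:+ (m ℕ:+ m) ℕ:* (ℕcon 1 ℕ:+ m))) ≡.refl

[q+1][q-1]+1≡q² : ∀ r → suc ((4 +ℕ r) *ℕ (2 +ℕ r)) ≡ (3 +ℕ r) *ℕ (3 +ℕ r)
[q+1][q-1]+1≡q² = ℕ-solve 1 (λ r → ℕcon 1 ℕ:+ (ℕcon 4 ℕ:+ r) ℕ:* (ℕcon 2 ℕ:+ r) ℕ:= (ℕcon 3 ℕ:+ r) ℕ:* (ℕcon 3 ℕ:+ r)) ≡.refl

length-eq : ∀ k → 4 +ℕ 4 *ℕ suc k ≡ (4 +ℕ (k +ℕ k)) +ℕ (4 +ℕ (k +ℕ k))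
length-eq = ℕ-solve 1 (λ k → ℕcon 4 ℕ:+ ℕcon 4 ℕ:* (ℕcon 1 ℕ:+ k) ℕ:= (ℕcon 4 ℕ:+ (k ℕ:+ k)) ℕ:+ (ℕcon 4 ℕ:+ (k ℕ:+ k))) ≡.refl

-- The successors in 3 + 2m′ let `bar x` unfold to `x * x ^ᴷ q-1`. That q is a power of 3 is passed
-- on through `3≈0`, `m×1≈1` and `frobenius-+`.
module PermutationTrinomial {c ℓ : Level} (K : CommutativeRing c ℓ) (m′ : ℕ)
  (FF : IsFiniteFieldOfOrder K ((3 +ℕ (m′ +ℕ m′)) *ℕ (3 +ℕ (m′ +ℕ m′))))
  (3≈0 : HasCharacteristicThree K) (m×1≈1 : IsOne K (suc m′)) (frobenius-+ : IsAdditivePower K (3 +ℕ (m′ +ℕ m′)))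
  where
  open CommutativeRing K hiding (zero)
  open IsFiniteFieldOfOrder FF
  open Pow K using (_^ᴷ_; polyF)
  open Polynomials K
  open FiniteField K FF
  open CharacteristicThree K 3≈0
  open Exp commutativeSemiring using (^-congˡ; ^-congʳ; ^-homo-*; ^-assocʳ; ^-distrib-*)
  open Mult semiring using (×-congʳ; ×-homo-+; ×-assoc-*) renaming (_×_ to _×ᴷ_)
  open GroupProperties +-group using (x∙y⁻¹≈ε⇒x≈y)
  open SetoidReasoning setoid

  m q q-1 : ℕ
  m = suc m′
  q = suc q-1
  q-1 = 2 +ℕ (m′ +ℕ m′)

  m+m≡q-1 : m +ℕ m ≡ q-1
  m+m≡q-1 = ≡.cong suc (ℕ.+-suc m′ m′)

  bar : Carrier → Carrier
  bar x = x ^ᴷ q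

  bar-cong : ∀ {x y} → x ≈ y → bar x ≈ bar y
  bar-cong = ^-congˡ q

  bar-* : ∀ x y → bar (x * y) ≈ bar x * bar y
  bar-* x y = ^-distrib-* x y q

  bar-bar : ∀ x → bar (bar x) ≈ x
  bar-bar x = trans (^-assocʳ x q q) (fermat x)

  bar-isInvolution : IsInvolution K bar
  bar-isInvolution = record { bar-cong = bar-cong ; bar-+ = frobenius-+ ; bar-* = bar-* ; bar-bar = bar-bar }

  open Conjugation K FF 3≈0 bar bar-isInvolution

  1^ : ∀ n → 1# ^ᴷ n ≈ 1#
  1^ zero = refl
  1^ (suc n) = trans (*-identityˡ _) (1^ n)

  fixed⇒^[q-1]≈1 : ∀ {x} → ¬ (x ≈ 0#) → bar x ≈ x → x ^ᴷ q-1 ≈ 1#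
  fixed⇒^[q-1]≈1 x≉0 x-fixed = *-cancelˡ x≉0 (trans x-fixed (sym (*-identityʳ _)))

  -- Take v - v̄ for some v moved by conjugation; X^q - X has too few roots for all v to be fixed.
  ∃-anti-fixed : ∃ λ ε → ¬ (ε ≈ 0#) × (bar ε ≈ - ε)
  ∃-anti-fixed with ∃-not-fixed (suc (m′ +ℕ m′)) 1+q≤q²
    where
    1+q≤q² : 1 +ℕ q ≤ q *ℕ q
    1+q≤q² = ℕ.≤-trans (ℕ.+-monoˡ-≤ q {1} {q} (s≤s z≤n)) (ℕ.+-monoʳ-≤ q (ℕ.m≤m+n q (suc (m′ +ℕ m′) *ℕ q)))
  ... | v , v-moves = v - bar v , (λ e → v-moves (sym (x∙y⁻¹≈ε⇒x≈y _ _ e))) ,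
    trans (bar-- v (bar v)) (trans (+-congˡ (-‿cong (bar-bar v))) (solve 2 (λ v w → w :- v := :- (v :- w)) refl v (bar v)))

  -- Half the order of the multiplicative group, factored as (q - 1)(m + 1): this power is 1 on
  -- nonzero squares and on nonzero elements of 𝔽_q.
  half-order : ∃ λ k → (suc k ≡ (m +ℕ m) *ℕ suc m) × (q *ℕ q ≡ suc (suc k +ℕ suc k))
  half-order = _ , ≡.refl , ≡.trans (≡.cong (λ k → suc k *ℕ suc k) (≡.sym m+m≡q-1)) (odd-square m)

  module _ (k : ℕ) (1+k≡2m[m+1] : suc k ≡ (m +ℕ m) *ℕ suc m) (q²≡1+2[1+k] : q *ℕ q ≡ suc (suc k +ℕ suc k)) where
    M = suc k

    M+2≤q² : 2 +ℕ M ≤ q *ℕ q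
    M+2≤q² = ℕ.≤-trans (s≤s (ℕ.+-monoˡ-≤ M {1} {M} (s≤s z≤n))) (ℕ.≤-reflexive (≡.sym q²≡1+2[1+k]))

    fixed⇒^[1+M]≈ : ∀ {d} → ¬ (d ≈ 0#) → bar d ≈ d → d ^ᴷ suc M ≈ d
    fixed⇒^[1+M]≈ {d} d≉0 d-fixed = trans (*-congˡ (begin
      d ^ᴷ M                     ≈⟨ ^-congʳ d 1+k≡2m[m+1] ⟩
      d ^ᴷ ((m +ℕ m) *ℕ suc m)   ≈⟨ ^-assocʳ d (m +ℕ m) (suc m) ⟨
      (d ^ᴷ (m +ℕ m)) ^ᴷ suc m   ≈⟨ ^-congˡ (suc m) (trans (^-congʳ d m+m≡q-1) (fixed⇒^[q-1]≈1 d≉0 d-fixed)) ⟩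
      1# ^ᴷ suc m                ≈⟨ 1^ (suc m) ⟩
      1#                         ∎)) (*-identityʳ d)

    square-fixed : ∀ x → (x * x) ^ᴷ suc M ≈ x * x
    square-fixed x = begin
      (x * x) ^ᴷ suc M            ≈⟨ ^-distrib-* x x (suc M) ⟩
      x ^ᴷ suc M * x ^ᴷ suc M     ≈⟨ ^-homo-* x (suc M) (suc M) ⟨
      x ^ᴷ (suc M +ℕ suc M)       ≈⟨ ^-congʳ x {suc M +ℕ suc M} {suc (q *ℕ q)} (≡.cong suc (≡.trans (ℕ.+-suc M M) (≡.sym q²≡1+2[1+k]))) ⟩
      x * x ^ᴷ (q *ℕ q)           ≈⟨ *-congˡ (fermat x) ⟩
      x * x                       ∎

    square-or-multiple⇒fixed : ∀ {d y} → ¬ (d ≈ 0#) → bar d ≈ d →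
      (∃ λ x → (x * x ≈ y) ⊎ (d * (x * x) ≈ y)) → y ^ᴷ suc M ≈ y
    square-or-multiple⇒fixed d≉0 d-fixed (x , inj₁ e) = trans (^-congˡ (suc M) (sym e)) (trans (square-fixed x) e)
    square-or-multiple⇒fixed {d} d≉0 d-fixed (x , inj₂ e) = trans (^-congˡ (suc M) (sym e))
      (trans (^-distrib-* d (x * x) (suc M)) (trans (*-cong (fixed⇒^[1+M]≈ d≉0 d-fixed) (square-fixed x)) e))

    -- Otherwise every y is a square or d times a square, hence fixed by the power 1 + M = (q² +
    -- 1)/2, whose degree is below q².
    not-nonsquare : ∀ {d} → bar d ≈ d → ¬ ¬ (∃ λ w → w * w ≈ d)
    not-nonsquare {d} d-fixed nonsquare = let y , y-moves = ∃-not-fixed k M+2≤q² in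
      y-moves (square-or-multiple⇒fixed (λ d≈0 → nonsquare (0# , trans (zeroˡ 0#) (sym d≈0))) d-fixed
        (square-or-multiple x≈-x⇒x≈0 d nonsquare y))

  -- Squareness is decidable by search, so the double negation yields an actual root.
  fixed⇒square : ∀ d → bar d ≈ d → ∃ λ w → w * w ≈ d
  fixed⇒square d d-fixed = decidable-stable (square? d)
    (let k , 1+k≡ , q²≡ = half-order in not-nonsquare k 1+k≡ q²≡ d-fixed)

  norm-polyF : ∀ a b x → (x * bar x) * polyF q a b x ≈ cubicForm a b x (bar x)
  norm-polyF a b x = begin
    (x * X) * (x * ((1# + a * (x ^ᴷ (q *ℕ q-1))) + b * (x ^ᴷ (2 *ℕ q-1))))
      ≈⟨ *-congˡ (*-congˡ (+-cong (+-congˡ (*-congˡ (sym (^-assocʳ x q q-1)))) (*-congˡ x^2[q-1]≈u²))) ⟩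
    (x * X) * (x * ((1# + a * U) + b * (u * u)))
      ≈⟨ solve 6 (λ a b x X u U → (x :* X) :* (x :* ((con 1̇ :+ a :* U) :+ b :* (u :* u)))
           := (a :* (x :* (x :* (X :* U))) :+ (x :* x) :* X) :+ b :* (X :* ((x :* u) :* (x :* u)))) refl a b x X u U ⟩
    (a * (x * (x * (X * U))) + (x * x) * X) + b * (X * ((x * u) * (x * u)))
      -- By definition of powers `x * u` is `bar x` and `X * U` is `bar X`; the latter remains to be
      -- rewritten.
      ≈⟨ +-congʳ (+-congʳ (*-congˡ (*-congˡ (*-congˡ (bar-bar x))))) ⟩
    cubicForm a b x X ∎
    where
    X = bar x
    u = x ^ᴷ q-1
    U = X ^ᴷ q-1
    x^2[q-1]≈u² : x ^ᴷ (2 *ℕ q-1) ≈ u * u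
    x^2[q-1]≈u² = trans (^-congʳ x (ℕ.*-comm 2 q-1)) (trans (sym (^-assocʳ x q-1 2)) (*-congˡ (*-identityʳ u)))

  q×≈0 : ∀ x → q ×ᴷ x ≈ 0#
  q×≈0 x = begin
    q ×ᴷ x                     ≈⟨ ×-congʳ q (*-identityˡ x) ⟨
    q ×ᴷ (1# * x)              ≈⟨ ×-assoc-* q 1# x ⟨
    (1# + q-1 ×ᴷ 1#) * x       ≈⟨ *-congʳ (+-congˡ (reflexive (≡.cong (_×ᴷ 1#) (≡.sym m+m≡q-1)))) ⟩
    (1# + (m +ℕ m) ×ᴷ 1#) * x  ≈⟨ *-congʳ (+-congˡ (trans (×-homo-+ 1# m m) (+-cong m×1≈1 m×1≈1))) ⟩
    (1# + (1# + 1#)) * x       ≈⟨ trans (*-congʳ 3≈0) (zeroˡ x) ⟩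
    0#                         ∎

  module _ (a b : Carrier) (a≉0 : ¬ (a ≈ 0#)) (b≉0 : ¬ (b ≈ 0#)) (bijective : Bijective _≈_ _≈_ (polyF q a b)) where
    ε = proj₁ ∃-anti-fixed

    open Discriminant ε (proj₁ (proj₂ ∃-anti-fixed)) (proj₂ (proj₂ ∃-anti-fixed)) fixed⇒square a b (polyF q a b)
      (norm-polyF a b) (λ x≈0 → trans (*-congʳ x≈0) (zeroˡ _)) (proj₁ bijective)
    open CoefficientRelations K 3≈0 (m′ +ℕ m′) m q×≈0 m×1≈1 a A b B

    D-square : ∀ v → ¬ (v ≈ 0#) → ∃ λ W → (bar W ≈ W) × ¬ (W ≈ 0#) × (W * W ≈ discriminant v (bar v))
    D-square v v≉0 = let x , f≈v = proj₂ bijective v in Fibre.discriminant-square v x v≉0 (f≈v refl)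

    discriminant-quartic : ∀ v u → discriminant v (v * u) ≈ ((v * v) * (v * v)) * eval quartic u
    discriminant-quartic v u = solve 6 (λ a A b B v u →
      ((v :* (v :* u)) :* (v :* (v :* u)) :+ (v :* (v :* u)) :* (a :* (v :* v) :+ A :* ((v :* u) :* (v :* u))))
        :- (B :* ((v :* v) :* (v :* v)) :+ b :* (((v :* u) :* (v :* u)) :* ((v :* u) :* (v :* u))))
      := ((v :* v) :* (v :* v)) :* (:- B :+ u :* (a :+ u :* (con 1̇ :+ u :* (A :+ u :* (:- b :+ u :* con 0̇)))))) refl a A b B v u

    square-^m : ∀ x → (x * x) ^ᴷ m ≈ x ^ᴷ q-1
    square-^m x = trans (^-distrib-* x x m) (trans (sym (^-homo-* x m m)) (^-congʳ x m+m≡q-1))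

    quartic-power : ∀ v → ¬ (v ≈ 0#) → let u = v ^ᴷ q-1 in (u * u) * eval quartic u ^ᴷ m ≈ 1#
    quartic-power v v≉0 = let u = v ^ᴷ q-1
                              W , W-fixed , W≉0 , W²≈D = D-square v v≉0 in begin
      -- As q - 1 = 2m, the m-th power of v² is u, so u² comes from the factor v⁴ in
      -- `discriminant-quartic`.
      (u * u) * eval quartic u ^ᴷ m                    ≈⟨ *-congʳ (*-cong (square-^m v) (square-^m v)) ⟨
      ((v * v) ^ᴷ m * (v * v) ^ᴷ m) * eval quartic u ^ᴷ m ≈⟨ *-congʳ (^-distrib-* (v * v) (v * v) m) ⟨
      ((v * v) * (v * v)) ^ᴷ m * eval quartic u ^ᴷ m   ≈⟨ ^-distrib-* _ _ m ⟨
      (((v * v) * (v * v)) * eval quartic u) ^ᴷ m      ≈⟨ ^-congˡ m (discriminant-quartic v u) ⟨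
      discriminant v (bar v) ^ᴷ m                      ≈⟨ ^-congˡ m W²≈D ⟨
      (W * W) ^ᴷ m                                     ≈⟨ square-^m W ⟩
      W ^ᴷ q-1                                         ≈⟨ fixed⇒^[q-1]≈1 W≉0 W-fixed ⟩
      1#                                               ∎

    v^[q-1]-unitary : ∀ v → ¬ (v ≈ 0#) → (v ^ᴷ q-1) ^ᴷ (1 +ℕ q) ≈ 1#
    v^[q-1]-unitary v v≉0 = let u = v ^ᴷ q-1 in *-cancelˡ v≉0 (begin
      v * (u * bar u)       ≈⟨ *-assoc v u (bar u) ⟨
      bar v * bar u         ≈⟨ bar-* v u ⟨
      bar (bar v)           ≈⟨ bar-bar v ⟩
      v                     ≈⟨ *-identityʳ v ⟨
      v * 1#                ∎)

    -- X² Pᵐ - 1 vanishes on the (q+1)-st roots of unity.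
    vanishing : List Carrier
    vanishing = - 1# ∷ 0# ∷ power quartic m

    eval-vanishing : ∀ v → ¬ (v ≈ 0#) → eval vanishing (v ^ᴷ q-1) ≈ 0#
    eval-vanishing v v≉0 = let u = v ^ᴷ q-1 in begin
      - 1# + u * (0# + u * eval (power quartic m) u) ≈⟨ +-congˡ (*-congˡ (+-congˡ (*-congˡ (eval-power quartic m u)))) ⟩
      - 1# + u * (0# + u * eval quartic u ^ᴷ m)      ≈⟨ solve 2 (λ u e → :- con 1̇ :+ u :* (con 0̇ :+ u :* e) := :- con 1̇ :+ (u :* u) :* e) refl u _ ⟩
      - 1# + (u * u) * eval quartic u ^ᴷ m           ≈⟨ +-congˡ (quartic-power v v≉0) ⟩
      - 1# + 1#                                      ≈⟨ -‿inverseˡ 1# ⟩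
      0#                                             ∎

    folded : ∀ {k} → k < 1 +ℕ q → coef vanishing k + coef vanishing (k +ℕ (1 +ℕ q)) ≈ 0#
    -- The powers are (q-1)-st, the block length is q + 1, and the bound (q + 1)(q - 1) + 1 ≤ q²
    -- holds with equality.
    folded = vanishing⇒folded-coefficients (suc (m′ +ℕ m′)) (1 +ℕ q) vanishing length≤ (ℕ.≤-reflexive ([q+1][q-1]+1≡q² (m′ +ℕ m′)))
      (λ v v≉0 → v^[q-1]-unitary v v≉0 , eval-vanishing v v≉0)
      where
      -- At most 4m + 3 coefficients against 2 (q + 1) = 4m + 4, so a single fold suffices.
      length≤ : length vanishing ≤ (1 +ℕ q) +ℕ (1 +ℕ q)
      length≤ = ℕ.≤-trans (s≤s (s≤s (length-power (- B) (a ∷ 1# ∷ A ∷ - b ∷ []) m))) (ℕ.≤-trans (ℕ.n≤1+n _) (ℕ.≤-reflexive (length-eq m′)))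

    coefficient-identity : A * B ≈ a * (b * B - a * A)
    -- The leading entries -1 and 0 shift indices by two: folding at 0, 1, 2, 3 gives C(q-1) = 1,
    -- C(q) = 0, C(0) + C(q+1) = 0 and C(1) + C(q+2) = 0.
    coefficient-identity = elimination
      (x∙y⁻¹≈ε⇒x≈y _ _ (trans (+-comm _ _) (folded (s≤s z≤n))))
      (trans (sym (+-identityˡ _)) (folded (s≤s (s≤s z≤n))))
      (folded (s≤s (s≤s (s≤s z≤n))))
      (folded (s≤s (s≤s (s≤s (s≤s z≤n)))))

    discriminant-cong : ∀ {v V V′} → V ≈ V′ → discriminant v V ≈ discriminant v V′
    discriminant-cong e = +-cong (+-cong (*-cong (*-congˡ e) (*-congˡ e)) (*-cong (*-congˡ e) (+-congˡ (*-congˡ (*-cong e e)))))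
      (-‿cong (+-congˡ (*-congˡ (*-cong (*-cong e e) (*-cong e e)))))

    norm-power : ∀ x → x ^ᴷ (q +ℕ 1) ≈ x * bar x
    norm-power x = trans (^-homo-* x q 1) (trans (*-congˡ (*-identityʳ x)) (*-comm (bar x) x))

    norm-identity : bar a * bar b ≈ a * ((b ^ᴷ (q +ℕ 1)) - (a ^ᴷ (q +ℕ 1)))
    norm-identity = trans coefficient-identity (*-congˡ (sym (+-cong (norm-power b) (-‿cong (norm-power a)))))

    norm-ratio : ∃ λ y → (bar y ≈ y) × ¬ (y ≈ 0#) × (y * y ≈ 1# - ((b * (a ⁻¹)) ^ᴷ (q +ℕ 1)))
    norm-ratio =
      let W , W-fixed , W≉0 , W²≈D = D-square 1# 1≉0
          y , y-fixed , y≉0 , ny²≈ = norm-ratio-square a≉0 b≉0 coefficient-identity W-fixed W≉0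
            (trans W²≈D (trans (discriminant-cong bar-1) (solve 4 (λ a A b B →
              ((con 1̇ :* con 1̇) :* (con 1̇ :* con 1̇) :+ (con 1̇ :* con 1̇) :* (a :* (con 1̇ :* con 1̇) :+ A :* (con 1̇ :* con 1̇)))
                :- (B :* ((con 1̇ :* con 1̇) :* (con 1̇ :* con 1̇)) :+ b :* ((con 1̇ :* con 1̇) :* (con 1̇ :* con 1̇)))
              := (con 1̇ :+ (a :+ A)) :- (B :+ b)) refl a A b B)))
      in y , y-fixed , y≉0 , *-cancelˡ (*-≉0 a≉0 (bar-≉0 a≉0)) (begin
        (a * A) * (y * y)              ≈⟨ ny²≈ ⟩
        a * A - b * B                  ≈⟨ +-congˡ (-‿cong nz≈bB) ⟨
        a * A - (a * A) * z            ≈⟨ solve 2 (λ n z → n :- n :* z := n :* (con 1̇ :- z)) refl (a * A) z ⟩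
        (a * A) * (1# - z)             ∎)
      where
      a′ = a ⁻¹
      z = (b * a′) ^ᴷ (q +ℕ 1)
      nz≈bB : (a * A) * z ≈ b * B
      nz≈bB = begin
        (a * A) * z                        ≈⟨ *-congˡ (trans (norm-power (b * a′)) (*-congˡ (bar-* b a′))) ⟩
        (a * A) * ((b * a′) * (B * bar a′)) ≈⟨ solve 6 (λ a A b B x X → (a :* A) :* ((b :* x) :* (B :* X)) := (b :* B) :* ((a :* x) :* (A :* X))) refl a A b B a′ (bar a′) ⟩
        (b * B) * ((a * a′) * (A * bar a′)) ≈⟨ *-congˡ (*-cong (⁻¹-inv a a≉0) (trans (sym (bar-* a a′)) (trans (bar-cong (⁻¹-inv a a≉0)) bar-1))) ⟩
        (b * B) * (1# * 1#)                ≈⟨ trans (*-congˡ (*-identityʳ 1#)) (*-identityʳ _) ⟩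
        b * B                              ∎

-- Specialisation to q = 3ⁿ.

-- This is (3ⁿ - 1)/2, written so that its being 1 modulo 3 for n ≥ 1 can be read off.
half : ℕ → ℕ
half zero = 0
half (suc n) = suc (3 *ℕ half n)

3^n≡1+2·half : ∀ n → 3 ^ℕ n ≡ suc (half n +ℕ half n)
3^n≡1+2·half zero = ≡.refl
3^n≡1+2·half (suc n) = ≡.trans (≡.cong (3 *ℕ_) (3^n≡1+2·half n))
  (ℕ-solve 1 (λ h → ℕcon 3 ℕ:* (ℕcon 1 ℕ:+ (h ℕ:+ h)) ℕ:= ℕcon 1 ℕ:+ ((ℕcon 1 ℕ:+ ℕcon 3 ℕ:* h) ℕ:+ (ℕcon 1 ℕ:+ ℕcon 3 ℕ:* h))) ≡.refl (half n))

module _ {c ℓ : Level} (K : CommutativeRing c ℓ) where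
  open CommutativeRing K hiding (zero)
  open Pow K using (_^ᴷ_; polyF)
  open Exp commutativeSemiring using (^-congˡ; ^-assocʳ)
  open Mult semiring using (×1-homo-*) renaming (_×_ to _×ᴷ_)
  open SetoidReasoning setoid

  [m^n]×1≈[m×1]^n : ∀ m n → (m ^ℕ n) ×ᴷ 1# ≈ (m ×ᴷ 1#) ^ᴷ n
  [m^n]×1≈[m×1]^n m zero = +-identityʳ 1#
  [m^n]×1≈[m×1]^n m (suc n) = trans (×1-homo-* m (m ^ℕ n)) (*-congˡ ([m^n]×1≈[m×1]^n m n))

  -- By `N×1≈0` the square of 3ⁿ is zero in K, and a field has no nilpotents.
  order-3^n·3^n⇒3≈0 : ∀ n → IsFiniteFieldOfOrder K ((3 ^ℕ n) *ℕ (3 ^ℕ n)) → HasCharacteristicThree K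
  order-3^n·3^n⇒3≈0 n FF = begin
    1# + (1# + 1#)  ≈⟨ +-congˡ (+-congˡ (+-identityʳ 1#)) ⟨
    3 ×ᴷ 1#         ≈⟨ ^≈0⇒≈0 n (trans (sym ([m^n]×1≈[m×1]^n 3 n)) q×1≈0) ⟩
    0#              ∎
    where
    open FiniteField K FF
    q×1≈0 : (3 ^ℕ n) ×ᴷ 1# ≈ 0#
    q×1≈0 = [ (λ e → e) , (λ e → e) ]′ (xy≈0⇒x≈0∨y≈0 (trans (sym (×1-homo-* (3 ^ℕ n) (3 ^ℕ n))) N×1≈0))

  module _ (3≈0 : HasCharacteristicThree K) where
    open CharacteristicThree K 3≈0

    frobenius-+ : ∀ n → IsAdditivePower K (3 ^ℕ n)
    frobenius-+ zero x y = trans (*-identityʳ _) (sym (+-cong (*-identityʳ x) (*-identityʳ y)))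
    frobenius-+ (suc n) x y = begin
      (x + y) ^ᴷ (3 ^ℕ suc n)                     ≈⟨ ^-assocʳ (x + y) 3 (3 ^ℕ n) ⟨
      ((x + y) ^ᴷ 3) ^ᴷ (3 ^ℕ n)                  ≈⟨ ^-congˡ (3 ^ℕ n) (solve 2 (λ x y →
                                                       (x :+ y) :* ((x :+ y) :* ((x :+ y) :* con 1̇)) := x :* (x :* (x :* con 1̇)) :+ y :* (y :* (y :* con 1̇))) refl x y) ⟩
      (x ^ᴷ 3 + y ^ᴷ 3) ^ᴷ (3 ^ℕ n)               ≈⟨ frobenius-+ n (x ^ᴷ 3) (y ^ᴷ 3) ⟩
      (x ^ᴷ 3) ^ᴷ (3 ^ℕ n) + (y ^ᴷ 3) ^ᴷ (3 ^ℕ n) ≈⟨ +-cong (^-assocʳ x 3 (3 ^ℕ n)) (^-assocʳ y 3 (3 ^ℕ n)) ⟩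
      x ^ᴷ (3 ^ℕ suc n) + y ^ᴷ (3 ^ℕ suc n)       ∎

    half×1≈1 : ∀ n → IsOne K (half (suc n))
    half×1≈1 n = trans (+-congˡ (trans (×1-homo-* 3 (half n)) (trans (*-congʳ (trans (+-congˡ (+-congˡ (+-identityʳ 1#))) 3≈0)) (zeroˡ _))))
      (+-identityʳ 1#)

  conclusion : ∀ m′ q → q ≡ 3 +ℕ (m′ +ℕ m′) → (FF : IsFiniteFieldOfOrder K (q *ℕ q)) →
    HasCharacteristicThree K → IsOne K (suc m′) → IsAdditivePower K q →
    ∀ a b → ¬ (a ≈ 0#) → ¬ (b ≈ 0#) → Bijective _≈_ _≈_ (polyF q a b) →
    let open IsFiniteFieldOfOrder FF in
    ((a ^ᴷ q) * (b ^ᴷ q) ≈ a * ((b ^ᴷ (q +ℕ 1)) - (a ^ᴷ (q +ℕ 1))))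
    × ∃ λ y → (y ^ᴷ q ≈ y) × ¬ (y ≈ 0#) × (y * y ≈ 1# - ((b * (a ⁻¹)) ^ᴷ (q +ℕ 1)))
  conclusion m′ q ≡.refl FF 3≈0 m×1≈1 frob a b a≉0 b≉0 bij = norm-identity a b a≉0 b≉0 bij , norm-ratio a b a≉0 b≉0 bij
    where
    open PermutationTrinomial K m′ FF 3≈0 m×1≈1 frob

theorem3p1 : {c ℓ : Level} (K : CommutativeRing c ℓ) (n : ℕ) → n ≥ 1 →
    (FF : IsFiniteFieldOfOrder K ((3 ^ℕ n) *ℕ (3 ^ℕ n))) →
    (a b : CommutativeRing.Carrier K) →
    ¬ (CommutativeRing._≈_ K a (CommutativeRing.0# K)) →
    ¬ (CommutativeRing._≈_ K b (CommutativeRing.0# K)) →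
    Bijective (CommutativeRing._≈_ K) (CommutativeRing._≈_ K) (Pow.polyF K (3 ^ℕ n) a b) →
    let open CommutativeRing K
        open IsFiniteFieldOfOrder FF
        q = 3 ^ℕ n
        open Pow K using (_^ᴷ_)
    in ((a ^ᴷ q) * (b ^ᴷ q) ≈ a * ((b ^ᴷ (q +ℕ 1)) - (a ^ᴷ (q +ℕ 1))))
       × ∃ λ y → (y ^ᴷ q ≈ y) × ¬ (y ≈ 0#) × (y * y ≈ 1# - ((b * (a ⁻¹)) ^ᴷ (q +ℕ 1)))
theorem3p1 K (suc n) n≥1 FF a b a≉0 b≉0 bij =
  let 3≈0 = order-3^n·3^n⇒3≈0 K (suc n) FF
      m′ = 3 *ℕ half n
  in conclusion K m′ (3 ^ℕ suc n) (≡.trans (3^n≡1+2·half (suc n)) (≡.cong (λ k → suc (suc k)) (ℕ.+-suc m′ m′))) FF 3≈0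
    (half×1≈1 K 3≈0 n) (frobenius-+ K 3≈0 (suc n)) a b a≉0 b≉0 bij
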